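{- Let $f=\sum_{i=0}^{d-1}c_it^i+t^d\in\mathcal{L}[t]$ be monic of degree $d\ge1$ with $c_0\ne0$, whose Newton polygon consists of exactly one edge, of slope $s$, and put $r=ds\in\mathbb{Z}$. Let $M$ be a left $\mathcal{L}[t]$-module isomorphic to $\mathcal{L}[t]/\mathcal{L}[t]f$. (1) There is an $\mathcal{O}$-lattice $\Lambda$ in $M$ with $\sigma^rt^d\Lambda=\Lambda$. If $s>0$, $\Lambda$ can moreover be chosen with $t^{ -1}\Lambda\subseteq\Lambda$. (2) If $u,v\in\mathbb{Z}$, $u\ne0$, and $\Lambda'$ is an $\mathcal{O}$-lattice in $M$ with $\sigma^vt^u\Lambda'=\Lambda'$, then $v/u=s$.
   Context: $(\mathcal{L},v)$ is a complete discretely valued skew field (division ring with a discrete valuation $v:\mathcal{L}\to\mathbb{Z}\cup\{\infty\}$, complete), with valuation ring $\mathcal{O}=\{v\ge0\}$ and a fixed uniformizer $\sigma$ ($v(\sigma)=1$). $\mathcal{L}[t]$ is the polynomial ring in a central indeterminate $t$; $t$ acts invertibly on $M$ here since $c_0\neq 0$. The Newton polygon of $f=\sum a_it^i$ is the lower convex hull of the points $(i,v(a_i))$ with $a_i\ne0$. An $\mathcal{O}$-lattice in a finite-dimensional left $\mathcal{L}$-vector space $M$ is a finitely generated $\mathcal{O}$-submodule containing an $\mathcal{L}$-basis of $M$. -}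

module Defs where

open import Algebra.Bundles using (Ring)
open import Algebra.Definitions using (Invertible)
open import Algebra.Module.Bundles using (LeftModule)
open import Algebra.Module.Morphism.Structures using (module LeftModuleMorphisms)
import Algebra.Definitions.RawMonoid as RawMonoid
import Algebra.Properties.CommutativeSemigroup
import Algebra.Properties.Ring
import Algebra.Properties.Semiring.Exp
open import Data.Fin.Base using (Fin)
open import Data.Integer.Base as ℤ using (ℤ; +_; -[1+_])
import Data.Integer.Properties as ℤ
open import Data.List.Base using (List; []; _∷_; map)
open import Data.Nat.Base as ℕ using (ℕ; zero; suc)
open import Data.Product.Base using (_×_; _,_; proj₁; proj₂; ∃; ∃-syntax)
open import Data.Rational.Base as ℚ using (ℚ; 0ℚ; 1ℚ)
import Data.Rational.Properties as ℚ
import Data.Rational.Unnormalised.Base as ℚᵘ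
open import Function.Bundles using (_⇔_; Equivalence)
open import Function.Definitions using (Bijective; Injective; Surjective)
open import Level using (Level; _⊔_) renaming (suc to lsuc)
open import Relation.Binary.Construct.Add.Supremum.NonStrict ℤ._≤_ using (_≤⁺_)
open import Relation.Binary.PropositionalEquality as ≡ using (_≡_; _≢_; refl)
import Relation.Binary.Reasoning.Setoid as SetoidReasoning
open import Relation.Nullary.Construct.Add.Supremum using (_⁺; [_]; ⊤⁺)
open import Relation.Nullary.Negation.Core using (¬_)
open import Relation.Unary using (Pred; _≐_)

private
  variable
    c ℓ m ℓm m′ ℓm′ p : Level

------------------------------------------------------------------------
-- ℤ ∪ {∞} is the library's ℤ ⁺, with ⊤⁺ as ∞.

infixl 6 _+∞_
_+∞_ : ℤ ⁺ → ℤ ⁺ → ℤ ⁺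
[ i ] +∞ [ j ] = [ i ℤ.+ j ]
[ i ] +∞ ⊤⁺    = ⊤⁺
⊤⁺    +∞ _     = ⊤⁺

infixl 7 _⊓∞_
_⊓∞_ : ℤ ⁺ → ℤ ⁺ → ℤ ⁺
[ i ] ⊓∞ [ j ] = [ i ℤ.⊓ j ]
[ i ] ⊓∞ ⊤⁺    = [ i ]
⊤⁺    ⊓∞ y     = y

------------------------------------------------------------------------
-- Rational numbers

fromℤ : ℤ → ℚ
fromℤ i = i ℚ./ 1

fromℤ-≢0 : ∀ {u} → u ≢ + 0 → fromℤ u ≢ 0ℚ
fromℤ-≢0 {u} u≢0 e with ℚ./-injective-≃ (ℚᵘ.mkℚᵘ u 0) (ℚᵘ.mkℚᵘ (+ 0) 0) e
... | ℚᵘ.*≡* u*1≡0 = u≢0 (≡.trans (≡.sym (ℤ.*-identityʳ u)) u*1≡0)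

quotient : (v u : ℤ) → u ≢ + 0 → ℚ
quotient v u u≢0 = (fromℤ v ℚ.÷ fromℤ u) {{ℚ.≢-nonZero (fromℤ-≢0 u≢0)}}

------------------------------------------------------------------------
-- Convex geometry in the plane.  Only convex hulls of finitely many points
-- with integer coordinates occur, and these are determined by their
-- rational points.

Point : Set
Point = ℚ × ℚ

-- The point (1 - μ) P + μ Q.
between : ℚ → Point → Point → Point
between μ (x , y) (x′ , y′) =
  (1ℚ ℚ.- μ) ℚ.* x ℚ.+ μ ℚ.* x′ , (1ℚ ℚ.- μ) ℚ.* y ℚ.+ μ ℚ.* y′

Segment : Point → Point → Pred Point _
Segment P Q R = ∃[ μ ] 0ℚ ℚ.≤ μ × μ ℚ.≤ 1ℚ × R ≡ between μ P Q

-- The smallest convex set containing S.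
data ConvexHull (S : Pred Point p) : Pred Point p where
  vertex  : ∀ {P} → S P → ConvexHull S P
  segment : ∀ {P Q R} → ConvexHull S P → ConvexHull S Q →
            Segment P Q R → ConvexHull S R

-- The lower boundary of the convex hull.
LowerConvexHull : Pred Point p → Pred Point p
LowerConvexHull S (x , y) =
  ConvexHull S (x , y) × (∀ y′ → ConvexHull S (x , y′) → y ℚ.≤ y′)

-- N consists of exactly one edge, of slope s.  The strict inequality
-- excludes a polygon degenerating to a point, which has no edge.
IsSingleEdge : Pred Point p → ℚ → Set p
IsSingleEdge N s = ∃[ P ] ∃[ Q ]
    proj₁ P ℚ.< proj₁ Q
  × proj₂ Q ℚ.- proj₂ P ≡ s ℚ.* (proj₁ Q ℚ.- proj₁ P)
  × N ≐ Segment P Q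

------------------------------------------------------------------------
-- Complete discretely valued skew fields

record CompleteDVSkewField c ℓ : Set (lsuc (c ⊔ ℓ)) where
  field
    ring : Ring c ℓ
  open Ring ring public
  field
    1≉0        : ¬ 1# ≈ 0#
    invertible : ∀ {x} → ¬ x ≈ 0# → Invertible _≈_ 1# _*_ x

    v      : Carrier → ℤ ⁺
    v-cong : ∀ {x y} → x ≈ y → v x ≡ v y
    v-∞    : ∀ x → v x ≡ ⊤⁺ ⇔ x ≈ 0#
    v-*    : ∀ x y → v (x * y) ≡ v x +∞ v y
    v-+    : ∀ x y → v x ⊓∞ v y ≤⁺ v (x + y)

  Cauchy : (ℕ → Carrier) → Set
  Cauchy x = ∀ (k : ℤ) → ∃[ N ] ∀ i j → N ℕ.≤ i → N ℕ.≤ j →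
             [ k ] ≤⁺ v (x i - x j)

  _⟶_ : (ℕ → Carrier) → Carrier → Set
  x ⟶ a = ∀ (k : ℤ) → ∃[ N ] ∀ i → N ℕ.≤ i → [ k ] ≤⁺ v (x i - a)

  field
    complete : ∀ x → Cauchy x → ∃[ a ] x ⟶ a

  -- The valuation ring.
  𝒪 : Pred Carrier _
  𝒪 x = [ + 0 ] ≤⁺ v x

  -- The existence of a uniformizer makes v normalised, i.e. v(ℒ*) = ℤ.
  IsUniformizer : Carrier → Set
  IsUniformizer σ = v σ ≡ [ + 1 ]

  open Algebra.Properties.Semiring.Exp semiring using (_^_)

  module _ {σ : Carrier} (σ-unif : IsUniformizer σ) where

    uniformizer≉0 : ¬ σ ≈ 0#
    uniformizer≉0 σ≈0
      with () ← ≡.trans (≡.sym σ-unif) (Equivalence.from (v-∞ σ) σ≈0)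

    uniformizer^ : ℤ → Carrier
    uniformizer^ (+ n)    = σ ^ n
    uniformizer^ -[1+ n ] = proj₁ (invertible uniformizer≉0) ^ suc n

------------------------------------------------------------------------
-- The polynomial ring R[t] in a central indeterminate t

module Polynomial (R : Ring c ℓ) where
  open Ring R renaming (refl to ≈-refl; sym to ≈-sym; trans to ≈-trans)
  open Algebra.Properties.Ring R using (-0#≈0#)
  open Algebra.Properties.CommutativeSemigroup +-commutativeSemigroup
    using (interchange)
  open SetoidReasoning setoid

  -- a₀ ∷ a₁ ∷ … stands for a₀ + a₁t + …; trailing zeros are allowed.
  Poly : Set c
  Poly = List Carrier

  coeff : Poly → ℕ → Carrier
  coeff []      _       = 0#
  coeff (a ∷ p) zero    = a
  coeff (a ∷ p) (suc i) = coeff p i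

  infix 4 _≋_
  record _≋_ (p q : Poly) : Set ℓ where
    constructor mk
    field at : ∀ i → coeff p i ≈ coeff q i
  open _≋_ public

  infixl 6 _⊕_
  _⊕_ : Poly → Poly → Poly
  []      ⊕ q       = q
  (a ∷ p) ⊕ []      = a ∷ p
  (a ∷ p) ⊕ (b ∷ q) = (a + b) ∷ (p ⊕ q)

  ⊖_ : Poly → Poly
  ⊖ p = map (-_) p

  infixr 8 _·_
  _·_ : Carrier → Poly → Poly
  a · p = map (a *_) p

  infixl 7 _⊗_
  _⊗_ : Poly → Poly → Poly
  []      ⊗ q = []
  (a ∷ p) ⊗ q = (a · q) ⊕ (0# ∷ (p ⊗ q))

  const : Carrier → Poly
  const a = a ∷ []

  t : Poly
  t = 0# ∷ 1# ∷ []

  IsMonicOfDegree : ℕ → Poly → Set ℓ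
  IsMonicOfDegree d p = coeff p d ≈ 1# × (∀ i → d ℕ.< i → coeff p i ≈ 0#)

  coeff-⊕ : ∀ p q i → coeff (p ⊕ q) i ≈ coeff p i + coeff q i
  coeff-⊕ []      q       i       = ≈-sym (+-identityˡ _)
  coeff-⊕ (a ∷ p) []      i       = ≈-sym (+-identityʳ _)
  coeff-⊕ (a ∷ p) (b ∷ q) zero    = ≈-refl
  coeff-⊕ (a ∷ p) (b ∷ q) (suc i) = coeff-⊕ p q i

  coeff-⊖ : ∀ p i → coeff (⊖ p) i ≈ - coeff p i
  coeff-⊖ []      i       = ≈-sym -0#≈0#
  coeff-⊖ (a ∷ p) zero    = ≈-refl
  coeff-⊖ (a ∷ p) (suc i) = coeff-⊖ p i

  coeff-· : ∀ a p i → coeff (a · p) i ≈ a * coeff p i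
  coeff-· a []      i       = ≈-sym (zeroʳ a)
  coeff-· a (b ∷ p) zero    = ≈-refl
  coeff-· a (b ∷ p) (suc i) = coeff-· a p i

  coeff-⊗-0 : ∀ a p q → coeff ((a ∷ p) ⊗ q) 0 ≈ a * coeff q 0
  coeff-⊗-0 a p q = begin
    coeff ((a ∷ p) ⊗ q) 0   ≈⟨ coeff-⊕ (a · q) _ 0 ⟩
    coeff (a · q) 0 + 0#    ≈⟨ +-identityʳ _ ⟩
    coeff (a · q) 0         ≈⟨ coeff-· a q 0 ⟩
    a * coeff q 0           ∎

  coeff-⊗-suc : ∀ a p q i →
    coeff ((a ∷ p) ⊗ q) (suc i) ≈ a * coeff q (suc i) + coeff (p ⊗ q) i
  coeff-⊗-suc a p q i =
    ≈-trans (coeff-⊕ (a · q) _ (suc i)) (+-congʳ (coeff-· a q (suc i)))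

  ≋-refl : ∀ {p} → p ≋ p
  ≋-refl .at i = ≈-refl

  ≋-sym : ∀ {p q} → p ≋ q → q ≋ p
  ≋-sym e .at i = ≈-sym (e .at i)

  ≋-trans : ∀ {p q r} → p ≋ q → q ≋ r → p ≋ r
  ≋-trans e f .at i = ≈-trans (e .at i) (f .at i)

  ∷-cong : ∀ {a b p q} → a ≈ b → p ≋ q → (a ∷ p) ≋ (b ∷ q)
  ∷-cong a≈b e .at zero    = a≈b
  ∷-cong a≈b e .at (suc i) = e .at i

  tail-≋ : ∀ {a b p q} → (a ∷ p) ≋ (b ∷ q) → p ≋ q
  tail-≋ e .at i = e .at (suc i)

  tail-≋[] : ∀ {a p} → (a ∷ p) ≋ [] → p ≋ []
  tail-≋[] e .at i = e .at (suc i)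

  ⊕-cong : ∀ {p p′ q q′} → p ≋ p′ → q ≋ q′ → p ⊕ q ≋ p′ ⊕ q′
  ⊕-cong {p} {p′} {q} {q′} e f .at i = begin
    coeff (p ⊕ q) i           ≈⟨ coeff-⊕ p q i ⟩
    coeff p i + coeff q i     ≈⟨ +-cong (e .at i) (f .at i) ⟩
    coeff p′ i + coeff q′ i   ≈⟨ coeff-⊕ p′ q′ i ⟨
    coeff (p′ ⊕ q′) i         ∎

  ⊖-cong : ∀ {p q} → p ≋ q → ⊖ p ≋ ⊖ q
  ⊖-cong {p} {q} e .at i = begin
    coeff (⊖ p) i   ≈⟨ coeff-⊖ p i ⟩
    - coeff p i     ≈⟨ -‿cong (e .at i) ⟩
    - coeff q i     ≈⟨ coeff-⊖ q i ⟨
    coeff (⊖ q) i   ∎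

  ·-cong : ∀ {a b p q} → a ≈ b → p ≋ q → a · p ≋ b · q
  ·-cong {a} {b} {p} {q} a≈b e .at i = begin
    coeff (a · p) i   ≈⟨ coeff-· a p i ⟩
    a * coeff p i     ≈⟨ *-cong a≈b (e .at i) ⟩
    b * coeff q i     ≈⟨ coeff-· b q i ⟨
    coeff (b · q) i   ∎

  ⊕-assoc : ∀ p q r → (p ⊕ q) ⊕ r ≋ p ⊕ (q ⊕ r)
  ⊕-assoc p q r .at i = begin
    coeff ((p ⊕ q) ⊕ r) i                   ≈⟨ coeff-⊕ (p ⊕ q) r i ⟩
    coeff (p ⊕ q) i + coeff r i             ≈⟨ +-congʳ (coeff-⊕ p q i) ⟩
    (coeff p i + coeff q i) + coeff r i     ≈⟨ +-assoc _ _ _ ⟩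
    coeff p i + (coeff q i + coeff r i)     ≈⟨ +-congˡ (coeff-⊕ q r i) ⟨
    coeff p i + coeff (q ⊕ r) i             ≈⟨ coeff-⊕ p (q ⊕ r) i ⟨
    coeff (p ⊕ (q ⊕ r)) i                   ∎

  ⊕-comm : ∀ p q → p ⊕ q ≋ q ⊕ p
  ⊕-comm p q .at i = begin
    coeff (p ⊕ q) i         ≈⟨ coeff-⊕ p q i ⟩
    coeff p i + coeff q i   ≈⟨ +-comm _ _ ⟩
    coeff q i + coeff p i   ≈⟨ coeff-⊕ q p i ⟨
    coeff (q ⊕ p) i         ∎

  ⊕-identityʳ : ∀ p → p ⊕ [] ≋ p
  ⊕-identityʳ p = ⊕-comm p []

  ⊖-inverseˡ : ∀ p → ⊖ p ⊕ p ≋ []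
  ⊖-inverseˡ p .at i = begin
    coeff (⊖ p ⊕ p) i          ≈⟨ coeff-⊕ (⊖ p) p i ⟩
    coeff (⊖ p) i + coeff p i  ≈⟨ +-congʳ (coeff-⊖ p i) ⟩
    - coeff p i + coeff p i    ≈⟨ -‿inverseˡ _ ⟩
    0#                         ∎

  ⊖-inverseʳ : ∀ p → p ⊕ ⊖ p ≋ []
  ⊖-inverseʳ p = ≋-trans (⊕-comm p (⊖ p)) (⊖-inverseˡ p)

  ⊗-congʳ : ∀ {p q q′} → q ≋ q′ → p ⊗ q ≋ p ⊗ q′
  ⊗-congʳ {[]}    e = ≋-refl
  ⊗-congʳ {a ∷ p} e =
    ⊕-cong (·-cong ≈-refl e) (∷-cong ≈-refl (⊗-congʳ {p} e))

  0·-zero : ∀ {a} q → a ≈ 0# → a · q ≋ []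
  0·-zero {a} q a≈0 .at i = begin
    coeff (a · q) i   ≈⟨ coeff-· a q i ⟩
    a * coeff q i     ≈⟨ *-congʳ a≈0 ⟩
    0# * coeff q i    ≈⟨ zeroˡ _ ⟩
    0#                ∎

  0∷[]≋[] : (0# ∷ []) ≋ []
  0∷[]≋[] .at zero    = ≈-refl
  0∷[]≋[] .at (suc i) = ≈-refl

  ⊗-zeroˡ : ∀ p q → p ≋ [] → p ⊗ q ≋ []
  ⊗-zeroˡ []      q e = ≋-refl
  ⊗-zeroˡ (a ∷ p) q e =
    ⊕-cong (0·-zero q (e .at 0))
      (≋-trans (∷-cong ≈-refl (⊗-zeroˡ p q (tail-≋[] e))) 0∷[]≋[])

  ⊗-congˡ : ∀ p p′ q → p ≋ p′ → p ⊗ q ≋ p′ ⊗ q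
  ⊗-congˡ []      p′       q e = ≋-sym (⊗-zeroˡ p′ q (≋-sym e))
  ⊗-congˡ (a ∷ p) []       q e = ⊗-zeroˡ (a ∷ p) q e
  ⊗-congˡ (a ∷ p) (b ∷ p′) q e =
    ⊕-cong (·-cong (e .at 0) ≋-refl)
      (∷-cong ≈-refl (⊗-congˡ p p′ q (tail-≋ e)))

  ⊗-cong : ∀ {p p′ q q′} → p ≋ p′ → q ≋ q′ → p ⊗ q ≋ p′ ⊗ q′
  ⊗-cong {p} {p′} {q} e f = ≋-trans (⊗-congˡ p p′ q e) (⊗-congʳ {p′} f)

  ⊕-interchange : ∀ p q r s → (p ⊕ q) ⊕ (r ⊕ s) ≋ (p ⊕ r) ⊕ (q ⊕ s)
  ⊕-interchange p q r s .at i = begin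
    coeff ((p ⊕ q) ⊕ (r ⊕ s)) i
      ≈⟨ expand p q r s ⟩
    (coeff p i + coeff q i) + (coeff r i + coeff s i)
      ≈⟨ interchange _ _ _ _ ⟩
    (coeff p i + coeff r i) + (coeff q i + coeff s i)
      ≈⟨ expand p r q s ⟨
    coeff ((p ⊕ r) ⊕ (q ⊕ s)) i ∎
    where
    expand : ∀ p q r s → coeff ((p ⊕ q) ⊕ (r ⊕ s)) i ≈
             (coeff p i + coeff q i) + (coeff r i + coeff s i)
    expand p q r s = ≈-trans (coeff-⊕ (p ⊕ q) (r ⊕ s) i)
                       (+-cong (coeff-⊕ p q i) (coeff-⊕ r s i))

  ·-distribˡ : ∀ a p q → a · (p ⊕ q) ≋ a · p ⊕ a · q
  ·-distribˡ a p q .at i = begin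
    coeff (a · (p ⊕ q)) i                  ≈⟨ coeff-· a (p ⊕ q) i ⟩
    a * coeff (p ⊕ q) i                    ≈⟨ *-congˡ (coeff-⊕ p q i) ⟩
    a * (coeff p i + coeff q i)            ≈⟨ distribˡ _ _ _ ⟩
    a * coeff p i + a * coeff q i          ≈⟨ +-cong (coeff-· a p i) (coeff-· a q i) ⟨
    coeff (a · p) i + coeff (a · q) i      ≈⟨ coeff-⊕ (a · p) (a · q) i ⟨
    coeff (a · p ⊕ a · q) i                ∎

  ·-distribʳ : ∀ p a b → (a + b) · p ≋ a · p ⊕ b · p
  ·-distribʳ p a b .at i = begin
    coeff ((a + b) · p) i                  ≈⟨ coeff-· (a + b) p i ⟩
    (a + b) * coeff p i                    ≈⟨ distribʳ _ _ _ ⟩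
    a * coeff p i + b * coeff p i          ≈⟨ +-cong (coeff-· a p i) (coeff-· b p i) ⟨
    coeff (a · p) i + coeff (b · p) i      ≈⟨ coeff-⊕ (a · p) (b · p) i ⟨
    coeff (a · p ⊕ b · p) i                ∎

  ·-assoc : ∀ a b p → (a * b) · p ≋ a · b · p
  ·-assoc a b p .at i = begin
    coeff ((a * b) · p) i   ≈⟨ coeff-· (a * b) p i ⟩
    (a * b) * coeff p i     ≈⟨ *-assoc _ _ _ ⟩
    a * (b * coeff p i)     ≈⟨ *-congˡ (coeff-· b p i) ⟨
    a * coeff (b · p) i     ≈⟨ coeff-· a (b · p) i ⟨
    coeff (a · b · p) i     ∎

  0∷-⊕ : ∀ p q → (0# ∷ (p ⊕ q)) ≋ (0# ∷ p) ⊕ (0# ∷ q)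
  0∷-⊕ p q = ∷-cong (≈-sym (+-identityˡ 0#)) ≋-refl

  ⊗-distribˡ : ∀ p q r → p ⊗ (q ⊕ r) ≋ p ⊗ q ⊕ p ⊗ r
  ⊗-distribˡ []      q r = ≋-refl
  ⊗-distribˡ (a ∷ p) q r = ≋-trans
    (⊕-cong (·-distribˡ a q r)
      (≋-trans (∷-cong ≈-refl (⊗-distribˡ p q r)) (0∷-⊕ (p ⊗ q) (p ⊗ r))))
    (⊕-interchange (a · q) (a · r) (0# ∷ p ⊗ q) (0# ∷ p ⊗ r))

  ⊗-distribʳ : ∀ r p q → (p ⊕ q) ⊗ r ≋ p ⊗ r ⊕ q ⊗ r
  ⊗-distribʳ r []      q       = ≋-refl
  ⊗-distribʳ r (a ∷ p) []      = ≋-sym (⊕-identityʳ _)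
  ⊗-distribʳ r (a ∷ p) (b ∷ q) = ≋-trans
    (⊕-cong (·-distribʳ r a b)
      (≋-trans (∷-cong ≈-refl (⊗-distribʳ r p q)) (0∷-⊕ (p ⊗ r) (q ⊗ r))))
    (⊕-interchange (a · r) (b · r) (0# ∷ p ⊗ r) (0# ∷ q ⊗ r))

  ·-⊗-assoc : ∀ a q r → (a · q) ⊗ r ≋ a · (q ⊗ r)
  ·-⊗-assoc a []      r = ≋-refl
  ·-⊗-assoc a (b ∷ q) r = ≋-trans
    (⊕-cong (·-assoc a b r)
      (∷-cong (≈-sym (zeroʳ a)) (·-⊗-assoc a q r)))
    (≋-sym (·-distribˡ a (b · r) (0# ∷ q ⊗ r)))

  0∷-⊗ : ∀ p q → (0# ∷ p) ⊗ q ≋ (0# ∷ (p ⊗ q))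
  0∷-⊗ p q = ⊕-cong (0·-zero q ≈-refl) ≋-refl

  ⊗-assoc : ∀ p q r → (p ⊗ q) ⊗ r ≋ p ⊗ (q ⊗ r)
  ⊗-assoc []      q r = ≋-refl
  ⊗-assoc (a ∷ p) q r = ≋-trans
    (⊗-distribʳ r (a · q) (0# ∷ p ⊗ q))
    (⊕-cong (·-⊗-assoc a q r)
      (≋-trans (0∷-⊗ (p ⊗ q) r) (∷-cong ≈-refl (⊗-assoc p q r))))

  const-⊗ : ∀ a p → const a ⊗ p ≋ a · p
  const-⊗ a p = ≋-trans (⊕-cong (≋-refl {a · p}) 0∷[]≋[]) (⊕-identityʳ _)

  ⊗-identityˡ : ∀ p → const 1# ⊗ p ≋ p
  ⊗-identityˡ p = ≋-trans (const-⊗ 1# p)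
    (mk λ i → ≈-trans (coeff-· 1# p i) (*-identityˡ _))

  ⊗-identityʳ : ∀ p → p ⊗ const 1# ≋ p
  ⊗-identityʳ []      = ≋-refl
  ⊗-identityʳ (a ∷ p) =
    ∷-cong (≈-trans (+-identityʳ _) (*-identityʳ a)) (⊗-identityʳ p)

  t-⊗ : ∀ p → t ⊗ p ≋ (0# ∷ p)
  t-⊗ p = ≋-trans (0∷-⊗ (const 1#) p) (∷-cong ≈-refl (⊗-identityˡ p))

  polynomialRing : Ring c ℓ
  polynomialRing = record
    { Carrier = Poly
    ; _≈_     = _≋_
    ; _+_     = _⊕_
    ; _*_     = _⊗_
    ; -_      = ⊖_
    ; 0#      = []
    ; 1#      = const 1#
    ; isRing  = record
      { +-isAbelianGroup = record
        { isGroup = record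
          { isMonoid = record
            { isSemigroup = record
              { isMagma = record
                { isEquivalence = record
                  { refl = ≋-refl ; sym = ≋-sym ; trans = ≋-trans }
                ; ∙-cong = ⊕-cong
                }
              ; assoc = ⊕-assoc
              }
            ; identity = (λ _ → ≋-refl) , ⊕-identityʳ
            }
          ; inverse = ⊖-inverseˡ , ⊖-inverseʳ
          ; ⁻¹-cong = ⊖-cong
          }
        ; comm = ⊕-comm
        }
      ; *-cong     = ⊗-cong
      ; *-assoc    = ⊗-assoc
      ; *-identity = ⊗-identityˡ , ⊗-identityʳ
      ; distrib    = ⊗-distribˡ , ⊗-distribʳ
      }
    }

  const-*-homo : ∀ a b → const (a * b) ≋ const a ⊗ const b
  const-*-homo a b = ≋-sym (const-⊗ a (const b))

  -- Restriction of scalars along R → R[t].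
  restrict : LeftModule polynomialRing m ℓm → LeftModule R m ℓm
  restrict M = record
    { Carrierᴹ = Carrierᴹ
    ; _≈ᴹ_     = _≈ᴹ_
    ; _+ᴹ_     = _+ᴹ_
    ; _*ₗ_     = λ a x → const a *ₗ x
    ; 0ᴹ       = 0ᴹ
    ; -ᴹ_      = -ᴹ_
    ; isLeftModule = record
      { isLeftSemimodule = record
        { +ᴹ-isCommutativeMonoid = +ᴹ-isCommutativeMonoid
        ; isPreleftSemimodule = record
          { *ₗ-cong      = λ a≈b → *ₗ-cong (∷-cong a≈b ≋-refl)
          ; *ₗ-zeroˡ     = λ x → ≈ᴹ-trans (*ₗ-cong 0∷[]≋[] ≈ᴹ-refl) (*ₗ-zeroˡ x)
          ; *ₗ-distribʳ  = λ x a b → *ₗ-distribʳ x (const a) (const b)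
          ; *ₗ-identityˡ = *ₗ-identityˡ
          ; *ₗ-assoc     = λ a b x →
              ≈ᴹ-trans (*ₗ-cong (const-*-homo a b) ≈ᴹ-refl) (*ₗ-assoc (const a) (const b) x)
          ; *ₗ-zeroʳ     = λ a → *ₗ-zeroʳ (const a)
          ; *ₗ-distribˡ  = λ a → *ₗ-distribˡ (const a)
          }
        }
      ; -ᴹ‿cong    = -ᴹ‿cong
      ; -ᴹ‿inverse = -ᴹ‿inverse
      }
    }
    where open LeftModule M

------------------------------------------------------------------------
-- Left modules

module _ {R : Ring c ℓ} where

  _≅_ : LeftModule R m ℓm → LeftModule R m′ ℓm′ → Set _
  M ≅ N = ∃ (LeftModuleMorphisms.IsLeftModuleIsomorphism
               (LeftModule.rawLeftModule M) (LeftModule.rawLeftModule N))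

module _ {R : Ring c ℓ} (M : LeftModule R m ℓm) where
  open LeftModule M

  image : (Carrierᴹ → Carrierᴹ) → Pred Carrierᴹ p → Pred Carrierᴹ _
  image φ Λ y = ∃[ x ] Λ x × y ≈ᴹ φ x

-- The left module R/Rf.
module CyclicModule (R : Ring c ℓ) (f : Ring.Carrier R) where
  open Ring R renaming (refl to ≈-refl; sym to ≈-sym; trans to ≈-trans)
  open Algebra.Properties.Ring R
  open Algebra.Properties.CommutativeSemigroup +-commutativeSemigroup
    using (interchange)
  open SetoidReasoning setoid

  infix 4 _∼_
  record _∼_ (x y : Carrier) : Set (c ⊔ ℓ) where
    constructor _by_
    field
      factor : Carrier
      proof  : x - y ≈ factor * f

  ≈⇒∼ : ∀ {x y} → x ≈ y → x ∼ y
  ≈⇒∼ {x} {y} e = 0# by (begin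
    x - y    ≈⟨ +-congʳ e ⟩
    y - y    ≈⟨ -‿inverseʳ y ⟩
    0#       ≈⟨ zeroˡ f ⟨
    0# * f   ∎)

  ∼-neg : ∀ {x y} → x ∼ y → (- x) ∼ (- y)
  ∼-neg {x} {y} (g by e) = (- g) by (begin
    - x - - y     ≈⟨ -‿+-comm x (- y) ⟩
    - (x - y)     ≈⟨ -‿cong e ⟩
    - (g * f)     ≈⟨ -‿distribˡ-* g f ⟩
    - g * f       ∎)

  ∼-sym : ∀ {x y} → x ∼ y → y ∼ x
  ∼-sym {x} {y} (g by e) = (- g) by (begin
    y - x          ≈⟨ +-congʳ (-‿involutive y) ⟨
    - - y - x      ≈⟨ +-comm _ _ ⟩
    - x - - y      ≈⟨ _∼_.proof (∼-neg (g by e)) ⟩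
    - g * f        ∎)

  ∼-+ : ∀ {x x′ y y′} → x ∼ x′ → y ∼ y′ → (x + y) ∼ (x′ + y′)
  ∼-+ {x} {x′} {y} {y′} (g by e) (h by e′) = (g + h) by (begin
    (x + y) - (x′ + y′)      ≈⟨ +-congˡ (-‿+-comm x′ y′) ⟨
    (x + y) + (- x′ - y′)    ≈⟨ interchange x y (- x′) (- y′) ⟩
    (x - x′) + (y - y′)      ≈⟨ +-cong e e′ ⟩
    g * f + h * f            ≈⟨ distribʳ f g h ⟨
    (g + h) * f              ∎)

  ∼-trans : ∀ {x y z} → x ∼ y → y ∼ z → x ∼ z
  ∼-trans {x} {y} {z} (g by e) (h by e′) = (g + h) by (begin
    x - z                    ≈⟨ +-congʳ (+-identityʳ x) ⟨
    (x + 0#) - z             ≈⟨ +-congʳ (+-congˡ (-‿inverseˡ y)) ⟨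
    (x + (- y + y)) - z      ≈⟨ +-congʳ (+-assoc x (- y) y) ⟨
    ((x - y) + y) - z        ≈⟨ +-assoc _ _ _ ⟩
    (x - y) + (y - z)        ≈⟨ +-cong e e′ ⟩
    g * f + h * f            ≈⟨ distribʳ f g h ⟨
    (g + h) * f              ∎)

  ∼-* : ∀ {a b x y} → a ≈ b → x ∼ y → (a * x) ∼ (b * y)
  ∼-* {a} {b} {x} {y} a≈b (g by e) = (b * g) by (begin
    a * x - b * y        ≈⟨ +-congʳ (*-congʳ a≈b) ⟩
    b * x - b * y        ≈⟨ +-congˡ (-‿distribʳ-* b y) ⟩
    b * x + b * - y      ≈⟨ distribˡ b x (- y) ⟨
    b * (x - y)          ≈⟨ *-congˡ e ⟩
    b * (g * f)          ≈⟨ *-assoc b g f ⟨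
    (b * g) * f          ∎)

  cyclicModule : LeftModule R c (c ⊔ ℓ)
  cyclicModule = record
    { Carrierᴹ = Carrier
    ; _≈ᴹ_     = _∼_
    ; _+ᴹ_     = _+_
    ; _*ₗ_     = _*_
    ; 0ᴹ       = 0#
    ; -ᴹ_      = -_
    ; isLeftModule = record
      { isLeftSemimodule = record
        { +ᴹ-isCommutativeMonoid = record
          { isMonoid = record
            { isSemigroup = record
              { isMagma = record
                { isEquivalence = record
                  { refl = ≈⇒∼ ≈-refl ; sym = ∼-sym ; trans = ∼-trans }
                ; ∙-cong = ∼-+
                }
              ; assoc = λ x y z → ≈⇒∼ (+-assoc x y z)
              }
            ; identity = (λ x → ≈⇒∼ (+-identityˡ x)) , (λ x → ≈⇒∼ (+-identityʳ x))
            }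
          ; comm = λ x y → ≈⇒∼ (+-comm x y)
          }
        ; isPreleftSemimodule = record
          { *ₗ-cong      = ∼-*
          ; *ₗ-zeroˡ     = λ x → ≈⇒∼ (zeroˡ x)
          ; *ₗ-distribʳ  = λ x a b → ≈⇒∼ (distribʳ x a b)
          ; *ₗ-identityˡ = λ x → ≈⇒∼ (*-identityˡ x)
          ; *ₗ-assoc     = λ a b x → ≈⇒∼ (*-assoc a b x)
          ; *ₗ-zeroʳ     = λ a → ≈⇒∼ (zeroʳ a)
          ; *ₗ-distribˡ  = λ a x y → ≈⇒∼ (distribˡ a x y)
          }
        }
      ; -ᴹ‿cong    = ∼-neg
      ; -ᴹ‿inverse = (λ x → ≈⇒∼ (-‿inverseˡ x)) , (λ x → ≈⇒∼ (-‿inverseʳ x))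
      }
    }

open CyclicModule using (cyclicModule) public

------------------------------------------------------------------------
-- 𝒪-lattices in left vector spaces

module Lattices (K : CompleteDVSkewField c ℓ)
                (V : LeftModule (CompleteDVSkewField.ring K) m ℓm) where
  open CompleteDVSkewField K using (Carrier; _≈_; _*_; 0#; 𝒪)
  open LeftModule V

  linearCombination : ∀ {n} → (Fin n → Carrier) → (Fin n → Carrierᴹ) → Carrierᴹ
  linearCombination a b = RawMonoid.sum +ᴹ-rawMonoid (λ i → a i *ₗ b i)

  record IsBasis {n} (b : Fin n → Carrierᴹ) : Set (c ⊔ ℓ ⊔ m ⊔ ℓm) where
    field
      independent : ∀ a → linearCombination a b ≈ᴹ 0ᴹ → ∀ i → a i ≈ 0#
      spanning    : ∀ x → ∃[ a ] x ≈ᴹ linearCombination a b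

  record Is𝒪Submodule (Λ : Pred Carrierᴹ p) : Set (c ⊔ m ⊔ ℓm ⊔ p) where
    field
      resp      : ∀ {x y} → x ≈ᴹ y → Λ x → Λ y
      0-closed  : Λ 0ᴹ
      +-closed  : ∀ {x y} → Λ x → Λ y → Λ (x +ᴹ y)
      *ₗ-closed : ∀ {a x} → 𝒪 a → Λ x → Λ (a *ₗ x)

  IsFinitelyGenerated : Pred Carrierᴹ p → Set _
  IsFinitelyGenerated Λ = ∃[ n ] ∃[ g ] (∀ (i : Fin n) → Λ (g i)) ×
    (∀ {x} → Λ x → ∃[ a ] (∀ i → 𝒪 (a i)) × x ≈ᴹ linearCombination a g)

  record IsLattice (Λ : Pred Carrierᴹ p) : Set (c ⊔ ℓ ⊔ m ⊔ ℓm ⊔ p) where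
    field
      is𝒪Submodule        : Is𝒪Submodule Λ
      isFinitelyGenerated : IsFinitelyGenerated Λ
      containsBasis       : ∃[ n ] ∃[ b ] IsBasis {n} b × (∀ i → Λ (b i))

------------------------------------------------------------------------
-- Polynomials over a complete discretely valued skew field

module _ (K : CompleteDVSkewField c ℓ) where
  open CompleteDVSkewField K
    renaming (refl to ≈-refl; sym to ≈-sym; trans to ≈-trans)
  open Polynomial ring
  open Algebra.Properties.Ring ring using (-‿distribˡ-*; -‿+-comm)

  -- The points (i , v(aᵢ)) with aᵢ ≠ 0, the latter meaning that v(aᵢ) is finite.
  NewtonPoints : Poly → Pred Point _
  NewtonPoints f P =
    ∃[ i ] ∃[ n ] v (coeff f i) ≡ [ n ] × P ≡ (fromℤ (+ i) , fromℤ n)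

  NewtonPolygon : Poly → Pred Point _
  NewtonPolygon f = LowerConvexHull (NewtonPoints f)

  module _ (f : Poly) (c₀≉0 : ¬ coeff f 0 ≈ 0#) where
    open CyclicModule polynomialRing f hiding (cyclicModule)
    open SetoidReasoning setoid

    private
      c₀ c₀⁻¹ : Carrier
      c₀   = coeff f 0
      c₀⁻¹ = proj₁ (invertible c₀≉0)

      cancel : ∀ a → a * c₀ ≈ 0# → a ≈ 0#
      cancel a e = begin
        a                  ≈⟨ *-identityʳ a ⟨
        a * 1#             ≈⟨ *-congˡ (proj₂ (proj₂ (invertible c₀≉0))) ⟨
        a * (c₀ * c₀⁻¹)    ≈⟨ *-assoc _ _ _ ⟨
        (a * c₀) * c₀⁻¹    ≈⟨ *-congʳ e ⟩
        0# * c₀⁻¹          ≈⟨ zeroˡ _ ⟩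
        0#                 ∎

      divide : ∀ p q → (0# ∷ p) ≋ q ⊗ f → ∃[ h ] p ≋ h ⊗ f
      divide p []      e = [] , tail-≋[] e
      divide p (a ∷ q) e = q , tail-≋ (≋-trans e
        (≋-trans (⊗-congˡ (a ∷ q) (0# ∷ q) f
          (∷-cong (cancel a (≈-trans (≈-sym (coeff-⊗-0 a q f)) (≈-sym (e .at 0)))) ≋-refl))
        (0∷-⊗ q f)))

      tail : Poly → Poly
      tail []      = []
      tail (a ∷ p) = p

      coeff-tail : ∀ p i → coeff (tail p) i ≈ coeff p (suc i)
      coeff-tail []      i = ≈-refl
      coeff-tail (a ∷ p) i = ≈-refl

    t-∼-injective : ∀ {p q} → t ⊗ p ∼ t ⊗ q → p ∼ q
    t-∼-injective {p} {q} (g by e) =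
      let h , e′ = divide (p ⊕ ⊖ q) g (≋-trans (≋-sym t-difference) e) in h by e′
      where
      t-difference : t ⊗ p ⊕ ⊖ (t ⊗ q) ≋ (0# ∷ (p ⊕ ⊖ q))
      t-difference = ≋-trans
        (⊕-cong (t-⊗ p) (⊖-cong (t-⊗ q)))
        (∷-cong (-‿inverseʳ 0#) ≋-refl)

    t-∼-surjective : ∀ p → ∃[ q ] t ⊗ q ∼ p
    t-∼-surjective []      = [] , ≈⇒∼ (≋-trans (t-⊗ []) 0∷[]≋[])
    t-∼-surjective (a ∷ p) = q , ∼-trans (≈⇒∼ (t-⊗ q)) (const b by mk difference)
      where
      b = - (a * c₀⁻¹)
      q = p ⊕ b · tail f

      difference : ∀ i → coeff ((0# ∷ q) ⊕ ⊖ (a ∷ p)) i ≈ coeff (const b ⊗ f) i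
      difference zero = begin
        0# - a                  ≈⟨ +-identityˡ _ ⟩
        - a                     ≈⟨ -‿cong (*-identityʳ a) ⟨
        - (a * 1#)              ≈⟨ -‿cong (*-congˡ (proj₁ (proj₂ (invertible c₀≉0)))) ⟨
        - (a * (c₀⁻¹ * c₀))     ≈⟨ -‿cong (*-assoc _ _ _) ⟨
        - ((a * c₀⁻¹) * c₀)     ≈⟨ -‿distribˡ-* _ _ ⟩
        b * c₀                  ≈⟨ coeff-⊗-0 b [] f ⟨
        coeff (const b ⊗ f) 0   ∎
      difference (suc i) = begin
        coeff (q ⊕ ⊖ p) i
          ≈⟨ coeff-⊕ q (⊖ p) i ⟩
        coeff q i + coeff (⊖ p) i
          ≈⟨ +-cong (coeff-⊕ p (b · tail f) i) (coeff-⊖ p i) ⟩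
        (coeff p i + coeff (b · tail f) i) - coeff p i
          ≈⟨ +-congʳ (+-comm _ _) ⟩
        (coeff (b · tail f) i + coeff p i) - coeff p i
          ≈⟨ +-assoc _ _ _ ⟩
        coeff (b · tail f) i + (coeff p i - coeff p i)
          ≈⟨ +-cong (≈-trans (coeff-· b (tail f) i) (*-congˡ (coeff-tail f i))) (-‿inverseʳ _) ⟩
        b * coeff f (suc i) + 0#
          ≈⟨ coeff-⊗-suc b [] f i ⟨
        coeff (const b ⊗ f) (suc i) ∎

    module _ (M : LeftModule polynomialRing m ℓm)
             (M≅ : M ≅ cyclicModule polynomialRing f) where
      open LeftModule M
      open LeftModuleMorphisms.IsLeftModuleIsomorphism (proj₂ M≅)
        using (injective; surjective; *ₗ-homo; ⟦⟧-cong)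

      private
        φ = proj₁ M≅

      t-injective : Injective _≈ᴹ_ _≈ᴹ_ (t *ₗ_)
      t-injective {x} {y} e = injective (t-∼-injective
        (∼-trans (∼-sym (*ₗ-homo t x)) (∼-trans (⟦⟧-cong e) (*ₗ-homo t y))))

      t-surjective : Surjective _≈ᴹ_ _≈ᴹ_ (t *ₗ_)
      t-surjective y =
        let q , tq∼φy = t-∼-surjective (φ y)
            x , φx∼q  = surjective q
        in x , λ {z} z≈x → injective
          (∼-trans (*ₗ-homo t z) (∼-trans (∼-* (≋-refl {t}) (φx∼q z≈x)) tq∼φy))

      t-bijective : Bijective _≈ᴹ_ _≈ᴹ_ (t *ₗ_)
      t-bijective = t-injective , t-surjective

      t⁻¹ : Carrierᴹ → Carrierᴹ
      t⁻¹ y = proj₁ (proj₂ t-bijective y)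

      -- The action of tᵘ on M.
      t^ : ℤ → Carrierᴹ → Carrierᴹ
      t^ (+ zero)     x = x
      t^ (+ suc n)    x = t *ₗ t^ (+ n) x
      t^ -[1+ zero ]  x = t⁻¹ x
      t^ -[1+ suc n ] x = t⁻¹ (t^ -[1+ n ] x)

      -- x ↦ σᵏtᵘx
      σ^t^ : ∀ {σ} → IsUniformizer σ → ℤ → ℤ → Carrierᴹ → Carrierᴹ
      σ^t^ σ-unif k u x = const (uniformizer^ σ-unif k) *ₗ t^ u x

{-# OPTIONS --safe #-}

-- Let e be the generator of M, and let Fil k consist of the elements p e with
-- d v(pᵢ) ≥ k + i r for all i, where r = - v(c₀) = d s.  That all points
-- (i , v(cᵢ)) lie on or above the edge says that f satisfies these
-- inequalities with k = - d r, so that reduction modulo f preserves them.  It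
-- follows that x ∈ Fil k if and only if t x ∈ Fil (k - r).  Hence x ↦ σᵛtᵘx
-- shifts the filtration by exactly d v - u r; for v = r and u = d this is 0,
-- and Λ = Fil 0 is a stable lattice.  Conversely, a lattice Λ′ lies in some
-- Fil k, and if it is stable under a map shifting the filtration by δ ≠ 0, it
-- lies in the intersection of all Fil k, which is 0.

module Submission where

open import Defs
open import Algebra.Bundles using (Ring)
open import Algebra.Module.Bundles using (LeftModule)
open import Algebra.Module.Morphism.Structures using (module LeftModuleMorphisms)
import Algebra.Properties.AbelianGroup
import Algebra.Properties.Monoid.Sum
import Algebra.Properties.Ring
import Algebra.Properties.Semiring.Exp
open import Data.Empty using (⊥-elim)
open import Data.Fin.Base as Fin using (Fin; toℕ)
open import Data.Integer.Base as ℤ using (ℤ; +_; -[1+_])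
import Data.Integer.DivMod as ℤ
import Data.Integer.Properties as ℤ
open import Data.Integer.Tactic.RingSolver using (solve-∀)
open import Data.List.Base using ([]; _∷_; tabulate)
open import Data.Nat.Base as ℕ using (ℕ; zero; suc)
import Data.Nat.Properties as ℕ
open import Data.Product.Base using (_×_; _,_; proj₁; proj₂; ∃; ∃-syntax)
open import Data.Rational.Base as ℚ using (ℚ; 0ℚ; 1ℚ)
import Data.Rational.Properties as ℚ
open import Data.Rational.Solver using (module +-*-Solver)
import Data.Rational.Unnormalised.Base as ℚᵘ
import Data.Rational.Unnormalised.Properties as ℚᵘ
open import Data.Sum.Base using (_⊎_; inj₁; inj₂)
open import Function.Base using (id; _∘_)
open import Function.Bundles using (Equivalence)
open import Level using (Level; _⊔_)
open import Relation.Binary.Construct.Add.Supremum.NonStrict ℤ._≤_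
  using (_≤⁺_; _≤⊤⁺; [_]; [≤]-injective)
open import Relation.Binary.Definitions using (tri<; tri≈; tri>)
open import Relation.Binary.PropositionalEquality
  using (_≡_; _≢_; refl; sym; trans; cong; cong₂; subst; subst₂; module ≡-Reasoning)
import Relation.Binary.Reasoning.Setoid as SetoidReasoning
open import Relation.Nullary.Construct.Add.Supremum using (_⁺; [_]; ⊤⁺)
open import Relation.Nullary.Negation.Core using (¬_; contradiction)
open import Relation.Unary using (Pred; _⊆_; _≐_)

-- The factor d in d v(pᵢ) ≥ k + i r keeps all weights integral although the slope s = r / d need
-- not be. Elements of `Fil k` may be represented by polynomials of any degree, which makes the
-- closure properties immediate; separatedness rests on the fact that reduction modulo the monic f
-- gives a unique representative of degree below d without losing weight. Going back from t x to x
-- divides by `c₀`, so a bound on v(c₀) would not do: the point (0 , v(c₀)) must lie on the edge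
-- itself. The endpoints of the edge are given only abstractly and are never computed. It suffices
-- that (0 , v(c₀)) and (d , 0) lie on the polygon, which steep supporting lines show; the chord
-- between them then lies on it too and carries both the slope and the inequalities. For s > 0 the
-- lattice `Fil 0` serves again, because t⁻¹ raises the filtration by r ≥ 0.

private
  module ℤ-+ = Algebra.Properties.AbelianGroup ℤ.+-0-abelianGroup
  variable
    c ℓ m ℓm ℓₚ : Level

-- Integers and rational numbers

i-j+j≡i : ∀ i j → (i ℤ.- j) ℤ.+ j ≡ i
i-j+j≡i = solve-∀

i+j-j≡i : ∀ i j → (i ℤ.+ j) ℤ.- j ≡ i
i+j-j≡i = solve-∀

-- Obtained as minus the floor of - i / d. The first property puts the basis vectors of the lattice
-- into `Fil 0`, the minimality makes coordinates integral.
ceiling : ∀ d .{{_ : ℕ.NonZero d}} i →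
          ∃[ q ] i ℤ.≤ + d ℤ.* q × (∀ n → i ℤ.≤ + d ℤ.* n → q ℤ.≤ n)
ceiling d@(suc _) i = ℤ.- q , upper , least
  where
  open ℤ.≤-Reasoning
  q = (ℤ.- i) ℤ./ℕ d

  swap : ∀ q d → ℤ.- (q ℤ.* d) ≡ d ℤ.* ℤ.- q
  swap = solve-∀

  upper : i ℤ.≤ + d ℤ.* ℤ.- q
  upper = begin
    i                    ≡⟨ ℤ.neg-involutive i ⟨
    ℤ.- ℤ.- i            ≤⟨ ℤ.neg-mono-≤ (ℤ.[n/ℕd]*d≤n (ℤ.- i) d) ⟩
    ℤ.- (q ℤ.* + d)      ≡⟨ swap q (+ d) ⟩
    + d ℤ.* ℤ.- q        ∎

  least : ∀ n → i ℤ.≤ + d ℤ.* n → ℤ.- q ℤ.≤ n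
  least n i≤dn = ℤ.≮⇒≥ λ n<-q → ℤ.<-irrefl refl (begin-strict
    ℤ.- i                    <⟨ ℤ.n<s[n/ℕd]*d (ℤ.- i) d ⟩
    ℤ.suc q ℤ.* + d          ≤⟨ ℤ.*-monoʳ-≤-nonNeg (+ d) (ℤ.i<j⇒suc[i]≤j
                                  (subst (ℤ._< ℤ.- n) (ℤ.neg-involutive q) (ℤ.neg-mono-< n<-q))) ⟩
    ℤ.- n ℤ.* + d            ≡⟨ ℤ.*-comm (ℤ.- n) (+ d) ⟩
    + d ℤ.* ℤ.- n            ≡⟨ ℤ.neg-distribʳ-* (+ d) n ⟨
    ℤ.- (+ d ℤ.* n)          ≤⟨ ℤ.neg-mono-≤ i≤dn ⟩
    ℤ.- i                    ∎)

-- `fromℤ` normalises by a gcd and is stuck on a variable; the laws below are therefore checked on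
-- unnormalised fractions with denominator 1.
toℚᵘ-fromℤ : ∀ i → ℚ.toℚᵘ (fromℤ i) ℚᵘ.≃ ℚᵘ.mkℚᵘ i 0
toℚᵘ-fromℤ i = ℚ.toℚᵘ-fromℚᵘ (ℚᵘ.mkℚᵘ i 0)

fromℤ-+ : ∀ i j → fromℤ (i ℤ.+ j) ≡ fromℤ i ℚ.+ fromℤ j
fromℤ-+ i j = ℚ.toℚᵘ-injective (begin
  ℚ.toℚᵘ (fromℤ (i ℤ.+ j))                  ≈⟨ toℚᵘ-fromℤ (i ℤ.+ j) ⟩
  ℚᵘ.mkℚᵘ (i ℤ.+ j) 0                       ≈⟨ ℚᵘ.*≡* (unit i j) ⟩
  ℚᵘ.mkℚᵘ i 0 ℚᵘ.+ ℚᵘ.mkℚᵘ j 0              ≈⟨ ℚᵘ.+-cong (toℚᵘ-fromℤ i) (toℚᵘ-fromℤ j) ⟨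
  ℚ.toℚᵘ (fromℤ i) ℚᵘ.+ ℚ.toℚᵘ (fromℤ j)    ≈⟨ ℚ.toℚᵘ-homo-+ (fromℤ i) (fromℤ j) ⟨
  ℚ.toℚᵘ (fromℤ i ℚ.+ fromℤ j)              ∎)
  where
  open ℚᵘ.≃-Reasoning
  unit : ∀ i j → (i ℤ.+ j) ℤ.* + 1 ≡ (i ℤ.* + 1 ℤ.+ j ℤ.* + 1) ℤ.* + 1
  unit = solve-∀

fromℤ-* : ∀ i j → fromℤ (i ℤ.* j) ≡ fromℤ i ℚ.* fromℤ j
fromℤ-* i j = ℚ.toℚᵘ-injective (begin
  ℚ.toℚᵘ (fromℤ (i ℤ.* j))                  ≈⟨ toℚᵘ-fromℤ (i ℤ.* j) ⟩
  ℚᵘ.mkℚᵘ i 0 ℚᵘ.* ℚᵘ.mkℚᵘ j 0              ≈⟨ ℚᵘ.*-cong (toℚᵘ-fromℤ i) (toℚᵘ-fromℤ j) ⟨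
  ℚ.toℚᵘ (fromℤ i) ℚᵘ.* ℚ.toℚᵘ (fromℤ j)    ≈⟨ ℚ.toℚᵘ-homo-* (fromℤ i) (fromℤ j) ⟨
  ℚ.toℚᵘ (fromℤ i ℚ.* fromℤ j)              ∎)
  where open ℚᵘ.≃-Reasoning

fromℤ-neg : ∀ i → fromℤ (ℤ.- i) ≡ ℚ.- fromℤ i
fromℤ-neg i = ℚ.toℚᵘ-injective (begin
  ℚ.toℚᵘ (fromℤ (ℤ.- i))    ≈⟨ toℚᵘ-fromℤ (ℤ.- i) ⟩
  ℚᵘ.- ℚᵘ.mkℚᵘ i 0          ≈⟨ ℚᵘ.-‿cong (toℚᵘ-fromℤ i) ⟨
  ℚᵘ.- ℚ.toℚᵘ (fromℤ i)     ≈⟨ ℚ.toℚᵘ-homo‿- (fromℤ i) ⟨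
  ℚ.toℚᵘ (ℚ.- fromℤ i)      ∎)
  where open ℚᵘ.≃-Reasoning

fromℤ-mono-≤ : ∀ {i j} → i ℤ.≤ j → fromℤ i ℚ.≤ fromℤ j
fromℤ-mono-≤ {i} {j} i≤j = ℚ.toℚᵘ-cancel-≤
  (ℚᵘ.≤-respˡ-≃ (ℚᵘ.≃-sym (toℚᵘ-fromℤ i)) (ℚᵘ.≤-respʳ-≃ (ℚᵘ.≃-sym (toℚᵘ-fromℤ j))
    (ℚᵘ.*≤* (ℤ.*-monoʳ-≤-nonNeg (+ 1) i≤j))))

fromℤ-cancel-≤ : ∀ {i j} → fromℤ i ℚ.≤ fromℤ j → i ℤ.≤ j
fromℤ-cancel-≤ {i} {j} i≤j = ℤ.*-cancelʳ-≤-pos i j (+ 1) (ℚᵘ.drop-*≤*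
  (ℚᵘ.≤-respˡ-≃ (toℚᵘ-fromℤ i) (ℚᵘ.≤-respʳ-≃ (toℚᵘ-fromℤ j) (ℚ.toℚᵘ-mono-≤ i≤j))))

÷-cancelʳ : ∀ p q .{{_ : ℚ.NonZero q}} → (p ℚ.÷ q) ℚ.* q ≡ p
÷-cancelʳ p q = begin
  (p ℚ.* ℚ.1/ q) ℚ.* q   ≡⟨ ℚ.*-assoc p (ℚ.1/ q) q ⟩
  p ℚ.* (ℚ.1/ q ℚ.* q)   ≡⟨ cong (p ℚ.*_) (ℚ.*-inverseˡ q) ⟩
  p ℚ.* 1ℚ               ≡⟨ ℚ.*-identityʳ p ⟩
  p                      ∎
  where open ≡-Reasoning

*-cancelʳ-≡ : ∀ {p q} r .{{_ : ℚ.NonZero r}} → p ℚ.* r ≡ q ℚ.* r → p ≡ q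
*-cancelʳ-≡ {p} {q} r e = begin
  p                      ≡⟨ lemma p ⟨
  (p ℚ.* r) ℚ.* ℚ.1/ r   ≡⟨ cong (ℚ._* ℚ.1/ r) e ⟩
  (q ℚ.* r) ℚ.* ℚ.1/ r   ≡⟨ lemma q ⟩
  q                      ∎
  where
  open ≡-Reasoning
  lemma : ∀ x → (x ℚ.* r) ℚ.* ℚ.1/ r ≡ x
  lemma x = trans (ℚ.*-assoc x r _) (trans (cong (x ℚ.*_) (ℚ.*-inverseʳ r)) (ℚ.*-identityʳ x))

-- From d v = u r = u d s, cancel first d and then u.
quotient-slope : ∀ d .{{_ : ℕ.NonZero d}} {r s v u} (u≢0 : u ≢ + 0) →
  fromℤ r ≡ fromℤ (+ d) ℚ.* s → + d ℤ.* v ≡ u ℤ.* r → quotient v u u≢0 ≡ s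
quotient-slope d {r} {s} {v} {u} u≢0 r≡ds dv≡ur = *-cancelʳ-≡ U (begin
    quotient v u u≢0 ℚ.* U    ≡⟨ ÷-cancelʳ (fromℤ v) U ⟩
    fromℤ v                   ≡⟨ *-cancelʳ-≡ D vD≡sUD ⟩
    s ℚ.* U                   ∎)
  where
  open ≡-Reasoning
  open +-*-Solver
  U = fromℤ u
  D = fromℤ (+ d)
  instance
    U≢0 : ℚ.NonZero U
    U≢0 = ℚ.≢-nonZero (fromℤ-≢0 u≢0)
    D≢0 : ℚ.NonZero D
    D≢0 = ℚ.pos⇒nonZero D {{ℚ.normalize-pos d 1}}
  vD≡sUD : fromℤ v ℚ.* D ≡ (s ℚ.* U) ℚ.* D
  vD≡sUD = begin
    fromℤ v ℚ.* D             ≡⟨ ℚ.*-comm (fromℤ v) D ⟩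
    D ℚ.* fromℤ v             ≡⟨ fromℤ-* (+ d) v ⟨
    fromℤ (+ d ℤ.* v)         ≡⟨ cong fromℤ dv≡ur ⟩
    fromℤ (u ℤ.* r)           ≡⟨ fromℤ-* u r ⟩
    U ℚ.* fromℤ r             ≡⟨ cong (U ℚ.*_) r≡ds ⟩
    U ℚ.* (D ℚ.* s)           ≡⟨ solve 3 (λ U D s → U :* (D :* s) := (s :* U) :* D) refl U D s ⟩
    (s ℚ.* U) ℚ.* D           ∎

-- Single-edged lower convex hulls

-- One coordinate of `between`, definitionally, so that matching a `Segment` proof with `refl`
-- produces `mix` terms.
mix : ℚ → ℚ → ℚ → ℚ
mix μ x y = (1ℚ ℚ.- μ) ℚ.* x ℚ.+ μ ℚ.* y

mix-mono : ∀ {μ x x′ y y′} → 0ℚ ℚ.≤ μ → μ ℚ.≤ 1ℚ → x ℚ.≤ x′ → y ℚ.≤ y′ →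
           mix μ x y ℚ.≤ mix μ x′ y′
mix-mono {μ} 0≤μ μ≤1 x≤x′ y≤y′ = ℚ.+-mono-≤
  (ℚ.*-monoˡ-≤-nonNeg (1ℚ ℚ.- μ) {{ℚ.nonNegative 0≤1-μ}} x≤x′)
  (ℚ.*-monoˡ-≤-nonNeg μ {{ℚ.nonNegative 0≤μ}} y≤y′)
  where
  0≤1-μ : 0ℚ ℚ.≤ 1ℚ ℚ.- μ
  0≤1-μ = subst (ℚ._≤ 1ℚ ℚ.- μ) (ℚ.+-inverseʳ μ) (ℚ.+-monoˡ-≤ (ℚ.- μ) μ≤1)

mix-idem : ∀ μ x → mix μ x x ≡ x
mix-idem = solve 2 (λ μ x → (con 1ℚ :- μ) :* x :+ μ :* x := x) refl
  where open +-*-Solver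

mix-mix : ∀ ν μ μ′ x y → mix ν (mix μ x y) (mix μ′ x y) ≡ mix (mix ν μ μ′) x y
mix-mix = solve 5 (λ ν μ μ′ x y →
    (con 1ℚ :- ν) :* ((con 1ℚ :- μ) :* x :+ μ :* y) :+ ν :* ((con 1ℚ :- μ′) :* x :+ μ′ :* y)
      := (con 1ℚ :- ((con 1ℚ :- ν) :* μ :+ ν :* μ′)) :* x :+ ((con 1ℚ :- ν) :* μ :+ ν :* μ′) :* y)
    refl
  where open +-*-Solver

-- A half-plane is convex: the functional A x + y commutes with `mix`, so the bound survives every
-- `segment` step.
hull-≥ : ∀ {S : Pred Point ℓₚ} A B → (∀ {x y} → S (x , y) → B ℚ.≤ A ℚ.* x ℚ.+ y) →
         ∀ {x y} → ConvexHull S (x , y) → B ℚ.≤ A ℚ.* x ℚ.+ y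
hull-≥ A B S≥B (vertex P∈S) = S≥B P∈S
hull-≥ A B S≥B (segment {x , y} {x′ , y′} P∈H Q∈H (μ , 0≤μ , μ≤1 , refl)) =
  subst₂ ℚ._≤_ (mix-idem μ B) (affine A μ x y x′ y′)
    (mix-mono 0≤μ μ≤1 (hull-≥ A B S≥B P∈H) (hull-≥ A B S≥B Q∈H))
  where
  open +-*-Solver
  affine : ∀ A μ x y x′ y′ → mix μ (A ℚ.* x ℚ.+ y) (A ℚ.* x′ ℚ.+ y′) ≡
                             A ℚ.* mix μ x x′ ℚ.+ mix μ y y′
  affine = solve 6 (λ A μ x y x′ y′ →
    (con 1ℚ :- μ) :* (A :* x :+ y) :+ μ :* (A :* x′ :+ y′) :=
    A :* ((con 1ℚ :- μ) :* x :+ μ :* x′) :+ ((con 1ℚ :- μ) :* y :+ μ :* y′)) refl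

-- On the vertical line through a minimiser of A x + y the term A x cancels, so no hull point lies
-- below it. The supporting line has slope - A.
supporting-line : ∀ {S : Pred Point ℓₚ} A {x y} → S (x , y) →
  (∀ {x′ y′} → S (x′ , y′) → A ℚ.* x ℚ.+ y ℚ.≤ A ℚ.* x′ ℚ.+ y′) → LowerConvexHull S (x , y)
supporting-line A {x} {y} P∈S S≥ = vertex P∈S , λ y′ R∈H →
  subst₂ ℚ._≤_ (cancel (A ℚ.* x) y) (cancel (A ℚ.* x) y′)
    (ℚ.+-monoʳ-≤ (ℚ.- (A ℚ.* x)) (hull-≥ A (A ℚ.* x ℚ.+ y) S≥ R∈H))
  where
  open +-*-Solver
  cancel : ∀ a b → ℚ.- a ℚ.+ (a ℚ.+ b) ≡ b
  cancel = solve 2 (λ a b → :- a :+ (a :+ b) := b) refl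

-- If the points have parameters μ₀ and μ₁ on the edge, both coordinate differences are those of its
-- endpoints multiplied by μ₁ - μ₀.
edge-slope : ∀ {N : Pred Point ℓₚ} {s x₀ y₀ x₁ y₁} → IsSingleEdge N s →
  N (x₀ , y₀) → N (x₁ , y₁) → y₁ ℚ.- y₀ ≡ s ℚ.* (x₁ ℚ.- x₀)
edge-slope {s = s} ((px , py) , (qx , qy) , _ , slope , N⊆ , _) P₀∈N P₁∈N
  with μ₀ , _ , _ , refl ← N⊆ P₀∈N
  with μ₁ , _ , _ , refl ← N⊆ P₁∈N = begin
    mix μ₁ py qy ℚ.- mix μ₀ py qy             ≡⟨ difference μ₁ μ₀ py qy ⟩
    (μ₁ ℚ.- μ₀) ℚ.* (qy ℚ.- py)               ≡⟨ cong ((μ₁ ℚ.- μ₀) ℚ.*_) slope ⟩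
    (μ₁ ℚ.- μ₀) ℚ.* (s ℚ.* (qx ℚ.- px))       ≡⟨ swap (μ₁ ℚ.- μ₀) s (qx ℚ.- px) ⟩
    s ℚ.* ((μ₁ ℚ.- μ₀) ℚ.* (qx ℚ.- px))       ≡⟨ cong (s ℚ.*_) (difference μ₁ μ₀ px qx) ⟨
    s ℚ.* (mix μ₁ px qx ℚ.- mix μ₀ px qx)     ∎
  where
  open ≡-Reasoning
  open +-*-Solver
  difference : ∀ μ ν x y → mix μ x y ℚ.- mix ν x y ≡ (μ ℚ.- ν) ℚ.* (y ℚ.- x)
  difference = solve 4 (λ μ ν x y →
    ((con 1ℚ :- μ) :* x :+ μ :* y) :- ((con 1ℚ :- ν) :* x :+ ν :* y)
      := (μ :- ν) :* (y :- x)) refl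
  swap : ∀ a b c → a ℚ.* (b ℚ.* c) ≡ b ℚ.* (a ℚ.* c)
  swap = solve 3 (λ a b c → a :* (b :* c) := b :* (a :* c)) refl

edge-convex : ∀ {N : Pred Point ℓₚ} {s x₀ y₀ x₁ y₁} → IsSingleEdge N s →
  N (x₀ , y₀) → N (x₁ , y₁) → ∀ {ν} → 0ℚ ℚ.≤ ν → ν ℚ.≤ 1ℚ → N (mix ν x₀ x₁ , mix ν y₀ y₁)
edge-convex ((px , py) , (qx , qy) , _ , _ , N⊆ , N⊇) P₀∈N P₁∈N {ν} 0≤ν ν≤1
  with μ₀ , 0≤μ₀ , μ₀≤1 , refl ← N⊆ P₀∈N
  with μ₁ , 0≤μ₁ , μ₁≤1 , refl ← N⊆ P₁∈N = N⊇
    ( mix ν μ₀ μ₁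
    , subst (ℚ._≤ mix ν μ₀ μ₁) (mix-idem ν 0ℚ) (mix-mono 0≤ν ν≤1 0≤μ₀ 0≤μ₁)
    , subst (mix ν μ₀ μ₁ ℚ.≤_) (mix-idem ν 1ℚ) (mix-mono 0≤ν ν≤1 μ₀≤1 μ₁≤1)
    , cong₂ _,_ (mix-mix ν μ₀ μ₁ px qx) (mix-mix ν μ₀ μ₁ py qy) )

-- Valuations

[]-injective : ∀ {i j : ℤ} → _≡_ {A = ℤ ⁺} [ i ] [ j ] → i ≡ j
[]-injective refl = refl

module Valuation (K : CompleteDVSkewField c ℓ) where
  open CompleteDVSkewField K
    renaming (refl to ≈-refl; sym to ≈-sym; trans to ≈-trans)
  open Algebra.Properties.Ring ring

  v≡∞⇒≈0 : ∀ {x} → v x ≡ ⊤⁺ → x ≈ 0#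
  v≡∞⇒≈0 = Equivalence.to (v-∞ _)

  ≈0⇒v≡∞ : ∀ {x} → x ≈ 0# → v x ≡ ⊤⁺
  ≈0⇒v≡∞ = Equivalence.from (v-∞ _)

  ≉0⇒v-finite : ∀ {x} → ¬ x ≈ 0# → ∃[ n ] v x ≡ [ n ]
  ≉0⇒v-finite {x} x≉0 with v x in eq
  ... | [ n ] = n , refl
  ... | ⊤⁺    = ⊥-elim (x≉0 (v≡∞⇒≈0 eq))

  -- The value k of 1 is finite because 1 ≠ 0, and 1 · 1 = 1 gives k + k = k.
  v-1 : v 1# ≡ [ + 0 ]
  v-1 with k , v1≡k ← ≉0⇒v-finite 1≉0 = trans v1≡k (cong [_]
    (ℤ-+.identityʳ-unique k k (sym ([]-injective (begin
      [ k ]            ≡⟨ v1≡k ⟨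
      v 1#             ≡⟨ v-cong (*-identityˡ 1#) ⟨
      v (1# * 1#)      ≡⟨ v-* 1# 1# ⟩
      v 1# +∞ v 1#     ≡⟨ cong₂ _+∞_ v1≡k v1≡k ⟩
      [ k ℤ.+ k ]      ∎)))))
    where open ≡-Reasoning

  v-inverse : ∀ {x y n} → x * y ≈ 1# → v x ≡ [ n ] → v y ≡ [ ℤ.- n ]
  v-inverse {x} {y} {n} xy≈1 vx≡n with v y in vy
                                  | trans (sym (v-* x y)) (trans (v-cong xy≈1) v-1)
  -- Now `e` says that n plus the value of y is 0; an infinite value of y would make the sum
  -- infinite.
  ... | e₁ | e rewrite vx≡n with e₁
  ...   | [ k ] = cong [_] (ℤ-+.inverseʳ-unique n k ([]-injective e))
  ...   | ⊤⁺ with () ← e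

  -- This reduces to v(-1) = 0: since (-1)(-1) = 1, the value k of -1 equals - k, and 2 k = 0 forces
  -- k = 0.
  v-neg : ∀ x → v (- x) ≡ v x
  v-neg x = begin
    v (- x)             ≡⟨ v-cong (-1*x≈-x x) ⟨
    v (- 1# * x)        ≡⟨ v-* (- 1#) x ⟩
    v (- 1#) +∞ v x     ≡⟨ cong (_+∞ v x) v-1′ ⟩
    [ + 0 ] +∞ v x      ≡⟨ 0+∞ (v x) ⟩
    v x                 ∎
    where
    open ≡-Reasoning
    0+∞ : ∀ k → [ + 0 ] +∞ k ≡ k
    0+∞ [ k ] = cong [_] (ℤ.+-identityˡ k)
    0+∞ ⊤⁺    = refl

    -1*-1≈1 : - 1# * - 1# ≈ 1#
    -1*-1≈1 = ≈-trans (-1*x≈-x (- 1#)) (-‿involutive 1#)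

    v-1′ : v (- 1#) ≡ [ + 0 ]
    v-1′ with v (- 1#) in e
    ... | ⊤⁺    with () ← trans (sym v-1) (trans (v-cong (≈-sym -1*-1≈1))
                            (trans (v-* (- 1#) (- 1#)) (cong (λ k → k +∞ k) e)))
    ... | [ k ] = cong [_] (ℤ.*-cancelˡ-≡ (+ 2) k (+ 0)
      (trans (double k) (trans (cong (ℤ._+_ k)
        ([]-injective (trans (sym e) (v-inverse -1*-1≈1 e)))) (ℤ.+-inverseʳ k))))
      where
      double : ∀ k → + 2 ℤ.* k ≡ k ℤ.+ k
      double = solve-∀

  -- The ultrametric inequality read backwards from a finite value of the sum, the form in which
  -- `_≼_` consumes it.
  v-+-≥ : ∀ {x y n} → v (x + y) ≡ [ n ] →
          ∃[ m ] m ℤ.≤ n × (v x ≡ [ m ] ⊎ v y ≡ [ m ])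
  v-+-≥ {x} {y} e with v x | v y | subst (v x ⊓∞ v y ≤⁺_) e (v-+ x y)
  ... | [ i ] | ⊤⁺    | [ i≤n ] = i , i≤n , inj₁ refl
  ... | ⊤⁺    | [ j ] | [ j≤n ] = j , j≤n , inj₂ refl
  ... | [ i ] | [ j ] | [ k≤n ] with ℤ.⊓-sel i j
  ...   | inj₁ k≡i = i , subst (ℤ._≤ _) k≡i k≤n , inj₁ refl
  ...   | inj₂ k≡j = j , subst (ℤ._≤ _) k≡j k≤n , inj₂ refl

  open Algebra.Properties.Semiring.Exp semiring using (_^_)

  v-^ : ∀ {x k} → v x ≡ [ k ] → ∀ n → v (x ^ n) ≡ [ + n ℤ.* k ]
  v-^ {x} {k} vx≡k zero    = trans v-1 (cong [_] (sym (ℤ.*-zeroˡ k)))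
  v-^ {x} {k} vx≡k (suc n) = begin
    v (x * x ^ n)           ≡⟨ v-* x (x ^ n) ⟩
    v x +∞ v (x ^ n)        ≡⟨ cong₂ _+∞_ vx≡k (v-^ vx≡k n) ⟩
    [ k ℤ.+ + n ℤ.* k ]     ≡⟨ cong [_] (ℤ.suc-* (+ n) k) ⟨
    [ + suc n ℤ.* k ]       ∎
    where open ≡-Reasoning

  v-uniformizer^ : ∀ {σ} (σ-unif : IsUniformizer σ) k → v (uniformizer^ σ-unif k) ≡ [ k ]
  v-uniformizer^ σ-unif (+ n)    = trans (v-^ σ-unif n) (cong [_] (ℤ.*-identityʳ (+ n)))
  v-uniformizer^ σ-unif -[1+ n ] = trans
    (v-^ (v-inverse (proj₂ (proj₂ (invertible (uniformizer≉0 σ-unif)))) σ-unif) (suc n))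
    (cong [_] (trans (ℤ.*-comm (+ suc n) (ℤ.- (+ 1))) (ℤ.-1*i≡-i (+ suc n))))

-- Newton polygons

module Newton (K : CompleteDVSkewField c ℓ) where
  open CompleteDVSkewField K
    renaming (refl to ≈-refl; sym to ≈-sym; trans to ≈-trans)
  open Polynomial ring
  open Valuation K

  coeff-v-bounded : ∀ f → ∃[ b ] ∀ i {n} → v (coeff f i) ≡ [ n ] → b ℤ.≤ n
  coeff-v-bounded [] = + 0 , λ i e → contradiction (trans (sym e) (≈0⇒v≡∞ ≈-refl)) λ ()
  coeff-v-bounded (a ∷ f) with b , b≤ ← coeff-v-bounded f with v a in va
  ... | ⊤⁺    = b , λ { zero e → contradiction (trans (sym e) va) λ () ; (suc i) e → b≤ i e }
  ... | [ k ] = k ℤ.⊓ b , λ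
    { zero    e → ℤ.≤-trans (ℤ.i⊓j≤i k b) (ℤ.≤-reflexive ([]-injective (trans (sym va) e)))
    ; (suc i) e → ℤ.≤-trans (ℤ.i⊓j≤j k b) (b≤ i e) }

  fromℤ-affine : ∀ a i n → fromℤ (a ℤ.* i ℤ.+ n) ≡ fromℤ a ℚ.* fromℤ i ℚ.+ fromℤ n
  fromℤ-affine a i n = trans (fromℤ-+ (a ℤ.* i) n) (cong (ℚ._+ fromℤ n) (fromℤ-* a i))

  newton-vertex : ∀ f a {i n} → v (coeff f i) ≡ [ n ] →
    (∀ {j m} → v (coeff f j) ≡ [ m ] → a ℤ.* + i ℤ.+ n ℤ.≤ a ℤ.* + j ℤ.+ m) →
    NewtonPolygon K f (fromℤ (+ i) , fromℤ n)
  newton-vertex f a {i} {n} e above = supporting-line (fromℤ a) (i , n , e , refl)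
    λ { (j , m , e′ , refl) → subst₂ ℚ._≤_ (fromℤ-affine a (+ i) n) (fromℤ-affine a (+ j) m)
          (fromℤ-mono-≤ (above e′)) }

  module _ {d f} (1≤d : 1 ℕ.≤ d) (monic : IsMonicOfDegree d f)
           {m₀} (vc₀ : v (coeff f 0) ≡ [ m₀ ]) where

    private
      v-lead : v (coeff f d) ≡ [ + 0 ]
      v-lead = trans (v-cong (proj₁ monic)) v-1

      degree-≥ : ∀ {i n} → v (coeff f i) ≡ [ n ] → i ℕ.≤ d
      degree-≥ {i} e = ℕ.≮⇒≥ λ d<i →
        contradiction (trans (sym e) (≈0⇒v≡∞ (proj₂ monic i d<i))) λ ()

      bound = proj₁ (coeff-v-bounded f)

      -- Lines of slopes ∓C through (0 , m₀) and (d , 0) support the polygon.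
      C : ℤ
      C = (m₀ ℤ.- bound) ℤ.⊔ (ℤ.- bound) ℤ.⊔ + 0

      0≤C : + 0 ℤ.≤ C
      0≤C = ℤ.i≤j⊔i _ (+ 0)

      C≤C*suc : ∀ i → C ℤ.≤ C ℤ.* + suc i
      C≤C*suc i = subst (ℤ._≤ C ℤ.* + suc i) (ℤ.*-identityʳ C)
        (ℤ.*-monoˡ-≤-nonNeg C {{ℤ.nonNegative 0≤C}} (ℤ.+≤+ (ℕ.s≤s ℕ.z≤n)))

      a-b≤c⇒a≤c+b : ∀ {a b c} → a ℤ.- b ℤ.≤ c → a ℤ.≤ c ℤ.+ b
      a-b≤c⇒a≤c+b {a} {b} {c} h = subst (ℤ._≤ c ℤ.+ b) (i-j+j≡i a b) (ℤ.+-monoˡ-≤ b h)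

      -- Equality at j = 0. For j ≥ 1 the gain C j ≥ C ≥ m₀ - `bound` compensates even for a
      -- coefficient of the smallest possible value.
      above-left : ∀ {j m} → v (coeff f j) ≡ [ m ] → C ℤ.* + 0 ℤ.+ m₀ ℤ.≤ C ℤ.* + j ℤ.+ m
      above-left {zero}      e = ℤ.≤-reflexive
        (cong (ℤ._+_ (C ℤ.* + 0)) ([]-injective (trans (sym vc₀) e)))
      above-left {suc j} {m} e = subst (ℤ._≤ C ℤ.* + suc j ℤ.+ m) (lemma C m₀)
        (ℤ.≤-trans (a-b≤c⇒a≤c+b {b = bound}
            (ℤ.≤-trans (ℤ.i≤i⊔j (m₀ ℤ.- bound) (ℤ.- bound)) (ℤ.i≤i⊔j _ (+ 0))))
          (ℤ.+-mono-≤ (C≤C*suc j) (proj₂ (coeff-v-bounded f) (suc j) e)))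
        where
        lemma : ∀ C m → m ≡ C ℤ.* + 0 ℤ.+ m
        lemma = solve-∀

      above-right : ∀ {j m} → v (coeff f j) ≡ [ m ] →
        ℤ.- C ℤ.* + d ℤ.+ + 0 ℤ.≤ ℤ.- C ℤ.* + j ℤ.+ m
      above-right {j} {m} e with ℕ.m≤n⇒m<n∨m≡n (degree-≥ e)
      ... | inj₂ refl = ℤ.≤-reflexive
        (cong (ℤ._+_ (ℤ.- C ℤ.* + d)) ([]-injective (trans (sym v-lead) e)))
      ... | inj₁ j<d = begin
        ℤ.- C ℤ.* + d ℤ.+ + 0
          ≤⟨ ℤ.+-monoʳ-≤ (ℤ.- C ℤ.* + d) gap ⟩
        ℤ.- C ℤ.* + d ℤ.+ (C ℤ.* + suc k ℤ.+ m)
          ≡⟨ cong (λ x → ℤ.- C ℤ.* x ℤ.+ (C ℤ.* + suc k ℤ.+ m)) d≡ ⟩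
        ℤ.- C ℤ.* (+ j ℤ.+ + suc k) ℤ.+ (C ℤ.* + suc k ℤ.+ m)
          ≡⟨ lemma C (+ j) (+ suc k) m ⟩
        ℤ.- C ℤ.* + j ℤ.+ m ∎
        where
        open ℤ.≤-Reasoning
        -- Thus d - j = k + 1 is visibly a successor, and C (d - j) ≥ C ≥ - `bound`.
        k = d ℕ.∸ suc j
        d≡ : + d ≡ + j ℤ.+ + suc k
        d≡ = cong +_ (trans (sym (ℕ.m+[n∸m]≡n j<d)) (sym (ℕ.+-suc j k)))
        gap : + 0 ℤ.≤ C ℤ.* + suc k ℤ.+ m
        gap = ℤ.≤-trans (a-b≤c⇒a≤c+b {+ 0} {bound}
                (subst (ℤ._≤ C) (sym (ℤ.+-identityˡ (ℤ.- bound)))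
                (ℤ.≤-trans (ℤ.i≤j⊔i (m₀ ℤ.- bound) (ℤ.- bound)) (ℤ.i≤i⊔j _ (+ 0)))))
              (ℤ.+-mono-≤ (C≤C*suc k) (proj₂ (coeff-v-bounded f) j e))
        lemma : ∀ C j k m → ℤ.- C ℤ.* (j ℤ.+ k) ℤ.+ (C ℤ.* k ℤ.+ m) ≡ ℤ.- C ℤ.* j ℤ.+ m
        lemma = solve-∀

      left : NewtonPolygon K f (fromℤ (+ 0) , fromℤ m₀)
      left = newton-vertex f C vc₀ above-left

      right : NewtonPolygon K f (fromℤ (+ d) , fromℤ (+ 0))
      right = newton-vertex f (ℤ.- C) v-lead above-right

    module _ {s} (edge : IsSingleEdge (NewtonPolygon K f) s) where

      -- The edge contains (0 , m₀) and (d , 0), whence - m₀ = s d. This makes - m₀ the integer r.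
      newton-slope : fromℤ (ℤ.- m₀) ≡ fromℤ (+ d) ℚ.* s
      newton-slope = begin
        fromℤ (ℤ.- m₀)                         ≡⟨ fromℤ-neg m₀ ⟩
        ℚ.- fromℤ m₀                           ≡⟨ ℚ.+-identityˡ _ ⟨
        0ℚ ℚ.- fromℤ m₀                        ≡⟨ edge-slope {s = s} edge left right ⟩
        s ℚ.* (fromℤ (+ d) ℚ.- 0ℚ)             ≡⟨ lemma s (fromℤ (+ d)) ⟩
        fromℤ (+ d) ℚ.* s                      ∎
        where
        open ≡-Reasoning
        open +-*-Solver
        lemma : ∀ s d → s ℚ.* (d ℚ.- 0ℚ) ≡ d ℚ.* s
        lemma = solve 2 (λ s d → s :* (d :- con 0ℚ) := d :* s) refl

      -- The chord from (0 , m₀) to (d , 0) is part of the lower hull, so its point of abscissa i is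
      -- not above (i , n). Multiplication by d clears the denominator.
      newton-≥ : ∀ i {n} → v (coeff f i) ≡ [ n ] → (+ d ℤ.- + i) ℤ.* m₀ ℤ.≤ + d ℤ.* n
      newton-≥ i {n} e = fromℤ-cancel-≤ (subst₂ ℚ._≤_ lhs (sym (fromℤ-* (+ d) n))
        (ℚ.*-monoˡ-≤-nonNeg D mix≤n))
        where
        D = fromℤ (+ d)
        instance
          d≢0 : ℕ.NonZero d
          d≢0 = ℕ.>-nonZero 1≤d
          D>0 : ℚ.Positive D
          D>0 = ℚ.normalize-pos d 1
          D≥0 : ℚ.NonNegative D
          D≥0 = ℚ.pos⇒nonNeg D
          D≢0 : ℚ.NonZero D
          D≢0 = ℚ.pos⇒nonZero D
        -- The parameter of abscissa i on the chord; it is at most 1 because a coefficient of finite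
        -- value has index at most d.
        ν = fromℤ (+ i) ℚ.÷ D
        νD≡i : ν ℚ.* D ≡ fromℤ (+ i)
        νD≡i = ÷-cancelʳ (fromℤ (+ i)) D
        0≤ν : 0ℚ ℚ.≤ ν
        0≤ν = ℚ.*-cancelʳ-≤-pos D (subst₂ ℚ._≤_ (sym (ℚ.*-zeroˡ D)) (sym νD≡i)
                (fromℤ-mono-≤ {+ 0} {+ i} (ℤ.+≤+ ℕ.z≤n)))
        ν≤1 : ν ℚ.≤ 1ℚ
        ν≤1 = ℚ.*-cancelʳ-≤-pos D (subst₂ ℚ._≤_ (sym νD≡i) (sym (ℚ.*-identityˡ D))
                (fromℤ-mono-≤ {+ i} {+ d} (ℤ.+≤+ (degree-≥ e))))
        open +-*-Solver
        mix-0 : ∀ ν D → mix ν 0ℚ D ≡ ν ℚ.* D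
        mix-0 = solve 2 (λ ν D → (con 1ℚ :- ν) :* con 0ℚ :+ ν :* D := ν :* D) refl
        mix≤n : mix ν (fromℤ m₀) 0ℚ ℚ.≤ fromℤ n
        mix≤n = proj₂ (edge-convex {s = s} edge left right 0≤ν ν≤1) (fromℤ n)
          (vertex (i , n , e , cong (_, fromℤ n) (trans (mix-0 ν D) νD≡i)))
        expand : ∀ D ν m → D ℚ.* mix ν m 0ℚ ≡ (D ℚ.- ν ℚ.* D) ℚ.* m
        expand = solve 3 (λ D ν m → D :* ((con 1ℚ :- ν) :* m :+ ν :* con 0ℚ) :=
                                    (D :- ν :* D) :* m) refl
        lhs : D ℚ.* mix ν (fromℤ m₀) 0ℚ ≡ fromℤ ((+ d ℤ.- + i) ℤ.* m₀)
        lhs = begin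
          D ℚ.* mix ν (fromℤ m₀) 0ℚ
            ≡⟨ expand D ν (fromℤ m₀) ⟩
          (D ℚ.- ν ℚ.* D) ℚ.* fromℤ m₀
            ≡⟨ cong (λ x → (D ℚ.- x) ℚ.* fromℤ m₀) νD≡i ⟩
          (D ℚ.- fromℤ (+ i)) ℚ.* fromℤ m₀
            ≡⟨ cong (λ x → (D ℚ.+ x) ℚ.* fromℤ m₀) (fromℤ-neg (+ i)) ⟨
          (D ℚ.+ fromℤ (ℤ.- + i)) ℚ.* fromℤ m₀
            ≡⟨ cong (ℚ._* fromℤ m₀) (fromℤ-+ (+ d) (ℤ.- + i)) ⟨
          fromℤ (+ d ℤ.- + i) ℚ.* fromℤ m₀
            ≡⟨ fromℤ-* (+ d ℤ.- + i) m₀ ⟨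
          fromℤ ((+ d ℤ.- + i) ℤ.* m₀) ∎
          where open ≡-Reasoning

-- Polynomials and cyclic modules

module PolynomialLemmas (R : Ring c ℓ) where
  open Ring R renaming (refl to ≈-refl; sym to ≈-sym; trans to ≈-trans)
  open Polynomial R

  -- With `t-⊗` this is the centrality of t: in a product acting on a vector, t may be made to act
  -- first.
  ⊗-t : ∀ p → p ⊗ t ≋ (0# ∷ p)
  ⊗-t []      = ≋-sym 0∷[]≋[]
  ⊗-t (a ∷ p) = ∷-cong
    (≈-trans (+-identityʳ _) (zeroʳ a))
    (≋-trans (⊕-cong (∷-cong (*-identityʳ a) ≋-refl) (⊗-t p))
      (∷-cong (+-identityʳ a) ≋-refl))

  coeff-tabulate : ∀ {n} (a : Fin n → Carrier) (h : ℕ → Carrier) →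
    (∀ i → a i ≈ h (toℕ i)) → (∀ j → n ℕ.≤ j → h j ≈ 0#) →
    ∀ j → coeff (tabulate a) j ≈ h j
  coeff-tabulate {zero}  a h a≈h h≈0 j       = ≈-sym (h≈0 j ℕ.z≤n)
  coeff-tabulate {suc n} a h a≈h h≈0 zero    = a≈h Fin.zero
  coeff-tabulate {suc n} a h a≈h h≈0 (suc j) = coeff-tabulate
    (λ i → a (Fin.suc i)) (λ i → h (suc i)) (λ i → a≈h (Fin.suc i))
    (λ i n≤i → h≈0 (suc i) (ℕ.s≤s n≤i)) j

  coeff-tabulate-toℕ : ∀ {n} (a : Fin n → Carrier) i → coeff (tabulate a) (toℕ i) ≡ a i
  coeff-tabulate-toℕ a Fin.zero    = refl
  coeff-tabulate-toℕ a (Fin.suc i) = coeff-tabulate-toℕ (λ i → a (Fin.suc i)) i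

  DegreeBelow : ℕ → Poly → Set ℓ
  DegreeBelow d p = ∀ i → d ℕ.≤ i → coeff p i ≈ 0#

  tabulate-DegreeBelow : ∀ {n} (a : Fin n → Carrier) → DegreeBelow n (tabulate a)
  tabulate-DegreeBelow {zero}  a i       n≤i         = ≈-refl
  tabulate-DegreeBelow {suc n} a (suc i) (ℕ.s≤s n≤i) =
    tabulate-DegreeBelow (λ j → a (Fin.suc j)) i n≤i

  -- Above degree d the summand a f of (a + t g) f contributes nothing, so g f again has degree
  -- below d and g = 0 by induction. The coefficient at d is then a itself.
  monic-multiple : ∀ {n f} → IsMonicOfDegree (suc n) f →
    ∀ g → DegreeBelow (suc n) (g ⊗ f) → g ≋ []
  monic-multiple monic [] below = ≋-refl
  monic-multiple {n} {f} monic (a ∷ g) below =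
    ≋-trans (∷-cong a≈0 g≋[]) 0∷[]≋[]
    where
    open SetoidReasoning setoid
    g≋[] : g ≋ []
    g≋[] = monic-multiple monic g λ i d≤i → begin
      coeff (g ⊗ f) i
        ≈⟨ +-identityˡ _ ⟨
      0# + coeff (g ⊗ f) i
        ≈⟨ +-congʳ (≈-trans (*-congˡ (proj₂ monic (suc i) (ℕ.s≤s d≤i))) (zeroʳ a)) ⟨
      a * coeff f (suc i) + coeff (g ⊗ f) i
        ≈⟨ coeff-⊗-suc a g f i ⟨
      coeff ((a ∷ g) ⊗ f) (suc i)
        ≈⟨ below (suc i) (ℕ.m≤n⇒m≤1+n d≤i) ⟩
      0# ∎
    a≈0 : a ≈ 0#
    a≈0 = begin
      a
        ≈⟨ *-identityʳ a ⟨
      a * 1#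
        ≈⟨ *-congˡ (proj₁ monic) ⟨
      a * coeff f (suc n)
        ≈⟨ +-identityʳ _ ⟨
      a * coeff f (suc n) + 0#
        ≈⟨ +-congˡ (⊗-zeroˡ g f g≋[] .at n) ⟨
      a * coeff f (suc n) + coeff (g ⊗ f) n
        ≈⟨ coeff-⊗-suc a g f n ⟨
      coeff ((a ∷ g) ⊗ f) (suc n)
        ≈⟨ below (suc n) ℕ.≤-refl ⟩
      0# ∎

module CyclicGenerator {R : Ring c ℓ} (f : Ring.Carrier R) (M : LeftModule R m ℓm)
                       (M≅ : M ≅ cyclicModule R f) where
  open Ring R renaming (refl to ≈-refl; sym to ≈-sym; trans to ≈-trans)
  open CyclicModule R f hiding (cyclicModule)
  open LeftModule M
  open LeftModuleMorphisms.IsLeftModuleIsomorphism (proj₂ M≅)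
    using (injective; surjective; *ₗ-homo; ⟦⟧-cong; 0ᴹ-homo)

  private
    φ = proj₁ M≅

  generator : Carrierᴹ
  generator = proj₁ (surjective 1#)

  -- The generator corresponds to the class of 1. The three facts below carry the description of
  -- R/Rf over to M in terms of this generator.
  φ-multiple : ∀ a → φ (a *ₗ generator) ∼ a
  φ-multiple a = ∼-trans (*ₗ-homo a generator)
    (∼-trans (∼-* ≈-refl (proj₂ (surjective 1#) ≈ᴹ-refl)) (≈⇒∼ (*-identityʳ a)))

  generates : ∀ x → ∃[ a ] x ≈ᴹ a *ₗ generator
  generates x = φ x , injective (∼-sym (φ-multiple (φ x)))

  relation : f *ₗ generator ≈ᴹ 0ᴹ
  relation = injective (∼-trans (φ-multiple f) (∼-trans f∼0 (∼-sym 0ᴹ-homo)))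
    where
    open Algebra.Properties.Ring R using (-0#≈0#)
    f∼0 : f ∼ 0#
    f∼0 = 1# by ≈-trans (+-congˡ -0#≈0#) (≈-trans (+-identityʳ f) (≈-sym (*-identityˡ f)))

  annihilator : ∀ a → a *ₗ generator ≈ᴹ 0ᴹ → ∃[ g ] a ≈ g * f
  annihilator a ae≈0
    with g by a-0≈gf ← ∼-trans (∼-sym (φ-multiple a)) (∼-trans (⟦⟧-cong ae≈0) 0ᴹ-homo) =
    g , ≈-trans (≈-sym (≈-trans (+-congˡ -0#≈0#) (+-identityʳ a))) a-0≈gf
    where open Algebra.Properties.Ring R using (-0#≈0#)

-- The weight filtration

module Weights (K : CompleteDVSkewField c ℓ) (d : ℕ) (r : ℤ) where
  open CompleteDVSkewField K
    renaming (refl to ≈-refl; sym to ≈-sym; trans to ≈-trans)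
  open Polynomial ring
  open Valuation K

  -- k ≼ a says that d v(a) ≥ k, and k ≼ᴾ p that d v(pᵢ) ≥ k + ir for all i.
  infix 4 _≼_ _≼ᴾ_
  record _≼_ (k : ℤ) (a : Carrier) : Set where
    constructor mk
    field at : ∀ n → v a ≡ [ n ] → k ℤ.≤ + d ℤ.* n

  record _≼ᴾ_ (k : ℤ) (p : Poly) : Set where
    constructor mk
    field at : ∀ i → k ℤ.+ + i ℤ.* r ≼ coeff p i
  open _≼ᴾ_ public

  v≡⇒≼ : ∀ {a n} → v a ≡ [ n ] → + d ℤ.* n ≼ a
  v≡⇒≼ va≡n ._≼_.at n′ va≡n′ =
    ℤ.≤-reflexive (cong (ℤ._*_ (+ d)) ([]-injective (trans (sym va≡n) va≡n′)))

  ≼-resp-≈ : ∀ {k a b} → a ≈ b → k ≼ a → k ≼ b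
  ≼-resp-≈ a≈b (mk h) = mk λ n vb → h n (trans (v-cong a≈b) vb)

  ≼-weaken : ∀ {j k a} → j ℤ.≤ k → k ≼ a → j ≼ a
  ≼-weaken j≤k (mk h) = mk λ n va → ℤ.≤-trans j≤k (h n va)

  ≼-subst : ∀ {j k a} → k ≡ j → k ≼ a → j ≼ a
  ≼-subst refl h = h

  ≼-0 : ∀ {k a} → a ≈ 0# → k ≼ a
  ≼-0 a≈0 ._≼_.at n va with () ← trans (sym va) (≈0⇒v≡∞ a≈0)

  ≼-+ : ∀ {k a b} → k ≼ a → k ≼ b → k ≼ a + b
  ≼-+ (mk h) (mk h′) ._≼_.at n va+b with v-+-≥ va+b
  ... | i , i≤n , inj₁ va = ℤ.≤-trans (h i va) (ℤ.*-monoˡ-≤-nonNeg (+ d) i≤n)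
  ... | i , i≤n , inj₂ vb = ℤ.≤-trans (h′ i vb) (ℤ.*-monoˡ-≤-nonNeg (+ d) i≤n)

  ≼-neg : ∀ {k a} → k ≼ a → k ≼ - a
  ≼-neg {a = a} (mk h) = mk λ n v-a → h n (trans (sym (v-neg a)) v-a)

  ≼-* : ∀ {j k a b} → j ≼ a → k ≼ b → j ℤ.+ k ≼ a * b
  ≼-* {j} {k} {a} {b} (mk h) (mk h′) ._≼_.at n vab
    with v a | v b | trans (sym (v-* a b)) vab
  ... | [ x ] | [ y ] | e = subst (j ℤ.+ k ℤ.≤_)
    (trans (sym (ℤ.*-distribˡ-+ (+ d) x y)) (cong (ℤ._*_ (+ d)) ([]-injective e)))
    (ℤ.+-mono-≤ (h x refl) (h′ y refl))

  𝒪⇒0≼ : ∀ {a} → 𝒪 a → + 0 ≼ a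
  𝒪⇒0≼ {a} 0≤va ._≼_.at n va = subst (ℤ._≤ + d ℤ.* n) (ℤ.*-zeroʳ (+ d))
    (ℤ.*-monoˡ-≤-nonNeg (+ d) ([≤]-injective (subst ([ + 0 ] ≤⁺_) va 0≤va)))

  ≼-exists : ∀ a → ∃[ k ] k ≼ a
  ≼-exists a with v a in va
  ... | [ n ] = + d ℤ.* n , v≡⇒≼ va
  ... | ⊤⁺    = + 0 , ≼-0 (v≡∞⇒≈0 va)

  ≼ᴾ-resp-≋ : ∀ {k p q} → p ≋ q → k ≼ᴾ p → k ≼ᴾ q
  ≼ᴾ-resp-≋ p≋q h = mk λ i → ≼-resp-≈ (p≋q .at i) (h .at i)

  ≼ᴾ-weaken : ∀ {j k p} → j ℤ.≤ k → k ≼ᴾ p → j ≼ᴾ p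
  ≼ᴾ-weaken j≤k h = mk λ i → ≼-weaken (ℤ.+-monoˡ-≤ (+ i ℤ.* r) j≤k) (h .at i)

  ≼ᴾ-[] : ∀ {k} → k ≼ᴾ []
  ≼ᴾ-[] = mk λ i → ≼-0 ≈-refl

  ≼ᴾ-⊕ : ∀ {k p q} → k ≼ᴾ p → k ≼ᴾ q → k ≼ᴾ p ⊕ q
  ≼ᴾ-⊕ {p = p} {q} h h′ = mk λ i →
    ≼-resp-≈ (≈-sym (coeff-⊕ p q i)) (≼-+ (h .at i) (h′ .at i))

  ≼ᴾ-· : ∀ {j k a p} → j ≼ a → k ≼ᴾ p → j ℤ.+ k ≼ᴾ a · p
  ≼ᴾ-· {j} {k} {a} {p} h h′ = mk λ i → ≼-resp-≈ (≈-sym (coeff-· a p i))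
    (≼-subst (sym (ℤ.+-assoc j k (+ i ℤ.* r))) (≼-* h (h′ .at i)))

  private
    weight-zero : ∀ k r → k ℤ.+ + 0 ℤ.* r ≡ k
    weight-zero = solve-∀

    weight-suc : ∀ k r i → (k ℤ.+ r) ℤ.+ i ℤ.* r ≡ k ℤ.+ (+ 1 ℤ.+ i) ℤ.* r
    weight-suc = solve-∀

  -- Prepending a coefficient raises the index of every other one by 1, which costs the additional
  -- r.
  ≼ᴾ-∷ : ∀ {k a p} → k ≼ a → k ℤ.+ r ≼ᴾ p → k ≼ᴾ a ∷ p
  ≼ᴾ-∷ {k} h h′ = mk λ
    { zero    → ≼-subst (sym (weight-zero k r)) h
    ; (suc i) → ≼-subst (weight-suc k r (+ i)) (h′ .at i) }

  ≼ᴾ-head : ∀ {k a p} → k ≼ᴾ a ∷ p → k ≼ a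
  ≼ᴾ-head {k} h = ≼-subst (weight-zero k r) (h .at 0)

  ≼ᴾ-tail : ∀ {k a p} → k ≼ᴾ a ∷ p → k ℤ.+ r ≼ᴾ p
  ≼ᴾ-tail {k} h = mk λ i → ≼-subst (sym (weight-suc k r (+ i))) (h .at (suc i))

  ≼ᴾ-exists : ∀ p → ∃[ k ] k ≼ᴾ p
  ≼ᴾ-exists []      = + 0 , ≼ᴾ-[]
  ≼ᴾ-exists (a ∷ p) with i , h ← ≼-exists a | j , h′ ← ≼ᴾ-exists p =
    i ℤ.⊓ (j ℤ.- r) , ≼ᴾ-∷ (≼-weaken (ℤ.i⊓j≤i i _) h)
      (≼ᴾ-weaken (subst (i ℤ.⊓ (j ℤ.- r) ℤ.+ r ℤ.≤_) (i-j+j≡i j r)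
        (ℤ.+-monoˡ-≤ r (ℤ.i⊓j≤j i (j ℤ.- r)))) h′)

  ≼ᴾ-all⇒≋[] : ∀ {p} → (∀ k → k ≼ᴾ p) → p ≋ []
  ≼ᴾ-all⇒≋[] {p} h .at i with v (coeff p i) in e
  ... | ⊤⁺    = v≡∞⇒≈0 e
  ... | [ n ] = ⊥-elim (ℤ.<-irrefl refl (ℤ.suc[i]≤j⇒i<j (subst (ℤ._≤ + d ℤ.* n)
      (collect (+ d ℤ.* n) (+ i ℤ.* r))
      -- This weight requires d v(pᵢ) ≥ d n + 1, against v(pᵢ) = n.
      (_≼_.at (h (+ 1 ℤ.+ (+ d ℤ.* n ℤ.- + i ℤ.* r)) .at i) n e))))
    where
    collect : ∀ x y → (+ 1 ℤ.+ (x ℤ.- y)) ℤ.+ y ≡ + 1 ℤ.+ x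
    collect = solve-∀

module Filtration (K : CompleteDVSkewField c ℓ) {σ}
                  (σ-unif : CompleteDVSkewField.IsUniformizer K σ) where
  open CompleteDVSkewField K
    renaming (refl to ≈-refl; sym to ≈-sym; trans to ≈-trans)
  open Polynomial ring
  open PolynomialLemmas ring
  open Valuation K

  inverse-cancel : ∀ {x x⁻¹} → x⁻¹ * x ≈ 1# → ∀ a → (a * x⁻¹) * x ≈ a
  inverse-cancel {x} {x⁻¹} inv a = begin
    (a * x⁻¹) * x    ≈⟨ *-assoc a x⁻¹ x ⟩
    a * (x⁻¹ * x)    ≈⟨ *-congˡ inv ⟩
    a * 1#           ≈⟨ *-identityʳ a ⟩
    a                ∎
    where open SetoidReasoning setoid

  -- With f given as `c₀ ∷ f′`, adding a multiple of f to a polynomial `a ∷ p` computes to a head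
  -- and a tail.
  module OfModule {n} (c₀ : Carrier) (f′ : Poly)
    (monic : IsMonicOfDegree (suc n) (c₀ ∷ f′)) (c₀≉0 : ¬ c₀ ≈ 0#)
    {m₀} (vc₀ : v c₀ ≡ [ m₀ ])
    (above-edge : ∀ i {k} → v (coeff (c₀ ∷ f′) i) ≡ [ k ] →
                  (+ suc n ℤ.- + i) ℤ.* m₀ ℤ.≤ + suc n ℤ.* k)
    (M : LeftModule polynomialRing m ℓm)
    (M≅ : M ≅ cyclicModule polynomialRing (c₀ ∷ f′)) where

    f : Poly
    f = c₀ ∷ f′

    d : ℕ
    d = suc n

    open LeftModule M
    open CyclicGenerator f M M≅ renaming (generator to e)
    open Algebra.Properties.Monoid.Sum +ᴹ-monoid using (sum; sum-cong-≋; sum-replicate-zero)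
    open SetoidReasoning ≈ᴹ-setoid

    r : ℤ
    r = ℤ.- m₀

    open Weights K d r

    private
      c₀⁻¹ : Carrier
      c₀⁻¹ = proj₁ (invertible c₀≉0)

      dr≼c₀⁻¹ : + d ℤ.* r ≼ c₀⁻¹
      dr≼c₀⁻¹ = v≡⇒≼ (v-inverse (proj₂ (proj₂ (invertible c₀≉0))) vc₀)

      -dr≼f : ℤ.- (+ d ℤ.* r) ≼ᴾ f
      -dr≼f = mk λ i → mk λ k vcᵢ →
        subst (ℤ._≤ + d ℤ.* k) (rearrange (+ d) (+ i) m₀) (above-edge i vcᵢ)
        where
        rearrange : ∀ d i m → (d ℤ.- i) ℤ.* m ≡ ℤ.- (d ℤ.* ℤ.- m) ℤ.+ i ℤ.* ℤ.- m
        rearrange = solve-∀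

    -- Reduction modulo f to representatives of degree below d

    const-*ₗ : ∀ a p x → (a · p) *ₗ x ≈ᴹ const a *ₗ (p *ₗ x)
    const-*ₗ a p x = ≈ᴹ-trans (*ₗ-cong (≋-sym (const-⊗ a p)) ≈ᴹ-refl) (*ₗ-assoc (const a) p x)

    t-*ₗ : ∀ p x → (0# ∷ p) *ₗ x ≈ᴹ t *ₗ (p *ₗ x)
    t-*ₗ p x = ≈ᴹ-trans (*ₗ-cong (≋-sym (t-⊗ p)) ≈ᴹ-refl) (*ₗ-assoc t p x)

    ·-f-annihilates : ∀ a → (a · f) *ₗ e ≈ᴹ 0ᴹ
    ·-f-annihilates a = ≈ᴹ-trans (const-*ₗ a f e)
      (≈ᴹ-trans (*ₗ-congˡ relation) (*ₗ-zeroʳ (const a)))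

    ⊕-·-f : ∀ p a → (p ⊕ a · f) *ₗ e ≈ᴹ p *ₗ e
    ⊕-·-f p a = begin
      (p ⊕ a · f) *ₗ e              ≈⟨ *ₗ-distribʳ e p (a · f) ⟩
      p *ₗ e +ᴹ (a · f) *ₗ e        ≈⟨ +ᴹ-congˡ (·-f-annihilates a) ⟩
      p *ₗ e +ᴹ 0ᴹ                  ≈⟨ +ᴹ-identityʳ _ ⟩
      p *ₗ e                        ∎

    -- Division with remainder in Horner form: if q is the remainder of p, then a + t q has degree
    -- at most d, and subtracting its coefficient `l` of tᵈ times f lowers the degree. The weight
    -- claim is for all k at once, since the recursion needs it at k + r.
    reduce : ∀ p → ∃[ q ] DegreeBelow d q × q *ₗ e ≈ᴹ p *ₗ e × (∀ k → k ≼ᴾ p → k ≼ᴾ q)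
    reduce []      = [] , (λ _ _ → ≈-refl) , ≈ᴹ-refl , λ _ h → h
    reduce (a ∷ p) with q , below , qe≈pe , weight ← reduce p =
      (a ∷ q) ⊕ (- l) · f , below′ , same , weight′
      where
      l = coeff q n

      below′ : DegreeBelow d ((a ∷ q) ⊕ (- l) · f)
      below′ (suc i) (ℕ.s≤s n≤i) = ≈-trans (coeff-⊕ (a ∷ q) ((- l) · f) (suc i))
        (≈-trans (+-congˡ (coeff-· (- l) f (suc i))) (vanish (ℕ.m≤n⇒m<n∨m≡n n≤i)))
        where
        vanish : n ℕ.< i ⊎ n ≡ i → coeff q i + - l * coeff f (suc i) ≈ 0#
        vanish (inj₁ n<i)  = ≈-trans
          (+-cong (below i n<i) (≈-trans (*-congˡ (proj₂ monic (suc i) (ℕ.s≤s n<i))) (zeroʳ _)))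
          (+-identityˡ 0#)
        vanish (inj₂ refl) = ≈-trans
          (+-congˡ (≈-trans (*-congˡ (proj₁ monic)) (*-identityʳ _))) (-‿inverseʳ l)

      split : ∀ p → (a ∷ p) *ₗ e ≈ᴹ const a *ₗ e +ᴹ t *ₗ (p *ₗ e)
      split p = begin
        (a ∷ p) *ₗ e                              ≈⟨ *ₗ-cong (∷-cong (≈-sym (+-identityʳ a)) ≋-refl) ≈ᴹ-refl ⟩
        (const a ⊕ (0# ∷ p)) *ₗ e                 ≈⟨ *ₗ-distribʳ e (const a) (0# ∷ p) ⟩
        const a *ₗ e +ᴹ (0# ∷ p) *ₗ e             ≈⟨ +ᴹ-congˡ (t-*ₗ p e) ⟩
        const a *ₗ e +ᴹ t *ₗ (p *ₗ e)             ∎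

      same : ((a ∷ q) ⊕ (- l) · f) *ₗ e ≈ᴹ (a ∷ p) *ₗ e
      same = begin
        ((a ∷ q) ⊕ (- l) · f) *ₗ e        ≈⟨ ⊕-·-f (a ∷ q) (- l) ⟩
        (a ∷ q) *ₗ e                      ≈⟨ split q ⟩
        const a *ₗ e +ᴹ t *ₗ (q *ₗ e)     ≈⟨ +ᴹ-congˡ (*ₗ-congˡ qe≈pe) ⟩
        const a *ₗ e +ᴹ t *ₗ (p *ₗ e)     ≈⟨ split p ⟨
        (a ∷ p) *ₗ e                      ∎

      weight′ : ∀ k → k ≼ᴾ a ∷ p → k ≼ᴾ (a ∷ q) ⊕ (- l) · f
      weight′ k h = ≼ᴾ-⊕ (≼ᴾ-∷ (≼ᴾ-head h) q-weight)
        -- At index n = d - 1 of q, the coefficient `l` has weight at least (k + r) + n r = k + d r,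
        -- which the weight - d r of f brings back to k.
        (≼ᴾ-weaken (ℤ.≤-reflexive (balance k r (+ n))) (≼ᴾ-· (≼-neg (q-weight .at n)) -dr≼f))
        where
        q-weight = weight (k ℤ.+ r) (≼ᴾ-tail h)
        balance : ∀ k r n → k ≡ ((k ℤ.+ r) ℤ.+ n ℤ.* r) ℤ.+ ℤ.- ((+ 1 ℤ.+ n) ℤ.* r)
        balance = solve-∀

    reduced-zero : ∀ {q} → DegreeBelow d q → q *ₗ e ≈ᴹ 0ᴹ → q ≋ []
    reduced-zero {q} below qe≈0 with g , q≋gf ← annihilator q qe≈0 =
      ≋-trans q≋gf (⊗-zeroˡ g f (monic-multiple monic g λ i d≤i →
        ≈-trans (≈-sym (q≋gf .at i)) (below i d≤i)))

    reduced-unique : ∀ {p q} → DegreeBelow d p → DegreeBelow d q → p *ₗ e ≈ᴹ q *ₗ e → p ≋ q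
    reduced-unique {p} {q} p-below q-below pe≈qe .at i = x∙y⁻¹≈ε⇒x≈y _ _ (≈-trans
      (≈-trans (+-congˡ (≈-sym (coeff-⊖ q i))) (≈-sym (coeff-⊕ p (⊖ q) i)))
      (reduced-zero below difference .at i))
      where
      open Algebra.Properties.Ring ring using (x∙y⁻¹≈ε⇒x≈y; -0#≈0#)
      below : DegreeBelow d (p ⊕ ⊖ q)
      below i d≤i = ≈-trans (coeff-⊕ p (⊖ q) i) (≈-trans
        (+-cong (p-below i d≤i) (≈-trans (coeff-⊖ q i) (≈-trans (-‿cong (q-below i d≤i)) -0#≈0#)))
        (+-identityˡ 0#))
      difference : (p ⊕ ⊖ q) *ₗ e ≈ᴹ 0ᴹ
      difference = begin
        (p ⊕ ⊖ q) *ₗ e             ≈⟨ *ₗ-distribʳ e p (⊖ q) ⟩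
        p *ₗ e +ᴹ (⊖ q) *ₗ e       ≈⟨ +ᴹ-congʳ pe≈qe ⟩
        q *ₗ e +ᴹ (⊖ q) *ₗ e       ≈⟨ *ₗ-distribʳ e q (⊖ q) ⟨
        (q ⊕ ⊖ q) *ₗ e             ≈⟨ *ₗ-cong (⊖-inverseʳ q) ≈ᴹ-refl ⟩
        [] *ₗ e                    ≈⟨ *ₗ-zeroˡ e ⟩
        0ᴹ                         ∎

    -- The filtration on M

    record Fil (k : ℤ) (x : Carrierᴹ) : Set (c ⊔ ℓm) where
      constructor fil
      field
        poly   : Poly
        weight : k ≼ᴾ poly
        value  : x ≈ᴹ poly *ₗ e

    Fil-resp : ∀ {k x y} → x ≈ᴹ y → Fil k x → Fil k y
    Fil-resp x≈y (fil p h x≈pe) = fil p h (≈ᴹ-trans (≈ᴹ-sym x≈y) x≈pe)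

    Fil-weaken : ∀ {j k x} → j ℤ.≤ k → Fil k x → Fil j x
    Fil-weaken j≤k (fil p h x≈pe) = fil p (≼ᴾ-weaken j≤k h) x≈pe

    Fil-subst : ∀ {j k x} → k ≡ j → Fil k x → Fil j x
    Fil-subst refl h = h

    Fil-0 : ∀ {k} → Fil k 0ᴹ
    Fil-0 = fil [] ≼ᴾ-[] (≈ᴹ-sym (*ₗ-zeroˡ e))

    Fil-+ : ∀ {k x y} → Fil k x → Fil k y → Fil k (x +ᴹ y)
    Fil-+ (fil p h x≈pe) (fil q h′ y≈qe) = fil (p ⊕ q) (≼ᴾ-⊕ h h′)
      (≈ᴹ-trans (+ᴹ-cong x≈pe y≈qe) (≈ᴹ-sym (*ₗ-distribʳ e p q)))

    Fil-*ₗ : ∀ {j k a x} → j ≼ a → Fil k x → Fil (j ℤ.+ k) (const a *ₗ x)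
    Fil-*ₗ {a = a} h (fil p h′ x≈pe) = fil (a · p) (≼ᴾ-· h h′)
      (≈ᴹ-trans (*ₗ-congˡ x≈pe) (≈ᴹ-sym (const-*ₗ a p e)))

    Fil-𝒪-*ₗ : ∀ {k a x} → 𝒪 a → Fil k x → Fil k (const a *ₗ x)
    Fil-𝒪-*ₗ {k} a∈𝒪 h = Fil-subst (ℤ.+-identityˡ k) (Fil-*ₗ (𝒪⇒0≼ a∈𝒪) h)

    Fil-sum : ∀ {k N} {x : Fin N → Carrierᴹ} → (∀ i → Fil k (x i)) → Fil k (sum x)
    Fil-sum {N = zero}  h = Fil-0
    Fil-sum {N = suc N} h = Fil-+ (h Fin.zero) (Fil-sum (h ∘ Fin.suc))

    Fil-exists : ∀ x → ∃[ k ] Fil k x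
    Fil-exists x with p , x≈pe ← generates x with k , h ← ≼ᴾ-exists p = k , fil p h x≈pe

    Fil-exists-family : ∀ {N} (x : Fin N → Carrierᴹ) → ∃[ k ] ∀ i → Fil k (x i)
    Fil-exists-family {zero}  x = + 0 , λ ()
    Fil-exists-family {suc N} x
      with j , h ← Fil-exists (x Fin.zero) | k , h′ ← Fil-exists-family (x ∘ Fin.suc) =
      j ℤ.⊓ k , λ { Fin.zero    → Fil-weaken (ℤ.i⊓j≤i j k) h
                  ; (Fin.suc i) → Fil-weaken (ℤ.i⊓j≤j j k) (h′ i) }

    -- The representative of x may change with k, but all of them reduce to the same q, which
    -- therefore has every weight. Level 0 only supplies some representative to start from.
    Fil-separated : ∀ {x} → (∀ k → Fil k x) → x ≈ᴹ 0ᴹ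
    Fil-separated {x} h
      with fil p _ x≈pe ← h (+ 0)
      with q , below , qe≈pe , _ ← reduce p = begin
        x           ≈⟨ x≈pe ⟩
        p *ₗ e      ≈⟨ qe≈pe ⟨
        q *ₗ e      ≈⟨ *ₗ-cong (≼ᴾ-all⇒≋[] q-weight) ≈ᴹ-refl ⟩
        [] *ₗ e     ≈⟨ *ₗ-zeroˡ e ⟩
        0ᴹ          ∎
      where
      q-weight : ∀ k → k ≼ᴾ q
      q-weight k with fil p′ h′ x≈p′e ← h k
                 with q′ , below′ , q′e≈p′e , weight′ ← reduce p′ =
        ≼ᴾ-resp-≋ (reduced-unique below′ below
          (≈ᴹ-trans q′e≈p′e (≈ᴹ-trans (≈ᴹ-sym x≈p′e) (≈ᴹ-trans x≈pe (≈ᴹ-sym qe≈pe)))))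
          (weight′ k h′)

    generator≉0 : ¬ e ≈ᴹ 0ᴹ
    generator≉0 e≈0 = 1≉0 (reduced-zero {const 1#} (λ { (suc i) _ → ≈-refl })
      (≈ᴹ-trans (*ₗ-identityˡ e) e≈0) .at 0)

    -- Maps that displace the filtration by an exact amount

    record Shift (δ : ℤ) (F : Carrierᴹ → Carrierᴹ) : Set (c ⊔ m ⊔ ℓm) where
      field
        F-cong     : ∀ {x y} → x ≈ᴹ y → F x ≈ᴹ F y
        surjective : ∀ y → ∃[ x ] F x ≈ᴹ y
        forward    : ∀ {k x} → Fil k x → Fil (k ℤ.+ δ) (F x)
        backward   : ∀ {k x} → Fil (k ℤ.+ δ) (F x) → Fil k x
    open Shift

    Shift-subst : ∀ {δ ε F} → δ ≡ ε → Shift δ F → Shift ε F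
    Shift-subst refl S = S

    Shift-id : Shift (+ 0) id
    Shift-id = record
      { F-cong     = id
      ; surjective = λ y → y , ≈ᴹ-refl
      ; forward    = λ {k} → Fil-subst (sym (ℤ.+-identityʳ k))
      ; backward   = λ {k} → Fil-subst (ℤ.+-identityʳ k)
      }

    Shift-∘ : ∀ {δ ε F G} → Shift δ F → Shift ε G → Shift (ε ℤ.+ δ) (F ∘ G)
    Shift-∘ {δ} {ε} S T = record
      { F-cong     = F-cong S ∘ F-cong T
      ; surjective = λ z → let y , Fy≈z = surjective S z ; x , Gx≈y = surjective T y
                           in x , ≈ᴹ-trans (F-cong S Gx≈y) Fy≈z
      ; forward    = λ {k} h → Fil-subst (ℤ.+-assoc k ε δ) (forward S (forward T h))
      ; backward   = λ {k} h → backward T (backward S (Fil-subst (sym (ℤ.+-assoc k ε δ)) h))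
      }

    Shift-const : ∀ {a k} → v a ≡ [ k ] → Shift (+ d ℤ.* k) (const a *ₗ_)
    Shift-const {a} {k} va≡k = record
      { F-cong     = *ₗ-congˡ
      ; surjective = λ y → const a⁻¹ *ₗ y , cancel aa⁻¹≈1 y
      ; forward    = λ {j} h → Fil-subst (ℤ.+-comm (+ d ℤ.* k) j) (Fil-*ₗ (v≡⇒≼ va≡k) h)
      ; backward   = λ {j} {x} h → Fil-subst (lemma (+ d) k j)
          (Fil-resp (cancel a⁻¹a≈1 x) (Fil-*ₗ (v≡⇒≼ (v-inverse aa⁻¹≈1 va≡k)) h))
      }
      where
      a≉0 : ¬ a ≈ 0#
      a≉0 a≈0 with () ← trans (sym va≡k) (≈0⇒v≡∞ a≈0)
      a⁻¹ = proj₁ (invertible a≉0)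
      a⁻¹a≈1 = proj₁ (proj₂ (invertible a≉0))
      aa⁻¹≈1 = proj₂ (proj₂ (invertible a≉0))
      cancel : ∀ {a b} → a * b ≈ 1# → ∀ x → const a *ₗ (const b *ₗ x) ≈ᴹ x
      cancel {a} {b} ab≈1 x = begin
        const a *ₗ (const b *ₗ x)     ≈⟨ *ₗ-assoc (const a) (const b) x ⟨
        (const a ⊗ const b) *ₗ x      ≈⟨ *ₗ-cong (≋-sym (const-*-homo a b)) ≈ᴹ-refl ⟩
        const (a * b) *ₗ x            ≈⟨ *ₗ-cong (∷-cong ab≈1 ≋-refl) ≈ᴹ-refl ⟩
        const 1# *ₗ x                 ≈⟨ *ₗ-identityˡ x ⟩
        x                             ∎
      lemma : ∀ d k j → d ℤ.* ℤ.- k ℤ.+ (j ℤ.+ d ℤ.* k) ≡ j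
      lemma = solve-∀

    Fil-t : ∀ {k x} → Fil k x → Fil (k ℤ.- r) (t *ₗ x)
    Fil-t {k} (fil p h x≈pe) = fil (0# ∷ p)
      (≼ᴾ-∷ (≼-0 ≈-refl) (≼ᴾ-weaken (ℤ.≤-reflexive (i-j+j≡i k r)) h))
      (≈ᴹ-trans (*ₗ-congˡ x≈pe) (≈ᴹ-sym (t-*ₗ p e)))

    private
      t-inj : ∀ {x y} → t *ₗ x ≈ᴹ t *ₗ y → x ≈ᴹ y
      t-inj = t-injective K f c₀≉0 M M≅

      t-inv : Carrierᴹ → Carrierᴹ
      t-inv = t⁻¹ K f c₀≉0 M M≅

      t-t-inv : ∀ x → t *ₗ t-inv x ≈ᴹ x
      t-t-inv x = proj₂ (t-surjective K f c₀≉0 M M≅ x) ≈ᴹ-refl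

    -- A multiple of f cancels the constant term of a representative of tx.
    Fil-t-cancel : ∀ {k x} → Fil k (t *ₗ x) → Fil (k ℤ.+ r) x
    Fil-t-cancel {k} {x} (fil [] h tx≈) = Fil-resp
      (t-inj (≈ᴹ-trans (*ₗ-zeroʳ t) (≈ᴹ-sym (≈ᴹ-trans tx≈ (*ₗ-zeroˡ e))))) Fil-0
    Fil-t-cancel {k} {x} (fil (a ∷ p) h tx≈) = fil q
      (≼ᴾ-⊕ (≼ᴾ-tail h) (≼ᴾ-weaken (ℤ.≤-reflexive (lemma k (+ d ℤ.* r) r))
        (≼ᴾ-· b-weight (≼ᴾ-tail -dr≼f))))
      (t-inj (begin
        t *ₗ x                        ≈⟨ tx≈ ⟩
        (a ∷ p) *ₗ e                  ≈⟨ ⊕-·-f (a ∷ p) b ⟨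
        ((a ∷ p) ⊕ b · f) *ₗ e        ≈⟨ *ₗ-cong (∷-cong head≈0 ≋-refl) ≈ᴹ-refl ⟩
        (0# ∷ q) *ₗ e                 ≈⟨ t-*ₗ q e ⟩
        t *ₗ (q *ₗ e)                 ∎))
      where
      open Algebra.Properties.Ring ring using (-‿distribˡ-*)
      b = - (a * c₀⁻¹)
      q = p ⊕ b · f′
      -- The inverse of `c₀` has value exactly r and contributes d r, so the product with the tail
      -- of f, of weight - d r + r, has weight k + r.
      b-weight : k ℤ.+ + d ℤ.* r ≼ b
      b-weight = ≼-neg (≼-* (≼ᴾ-head h) dr≼c₀⁻¹)
      lemma : ∀ k x r → k ℤ.+ r ≡ (k ℤ.+ x) ℤ.+ (ℤ.- x ℤ.+ r)
      lemma = solve-∀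
      head≈0 : a + b * c₀ ≈ 0#
      head≈0 = ≈-trans
        (+-congˡ (≈-trans (≈-sym (-‿distribˡ-* _ _))
          (-‿cong (inverse-cancel (proj₁ (proj₂ (invertible c₀≉0))) a))))
        (-‿inverseʳ a)

    Shift-t : Shift (ℤ.- r) (t *ₗ_)
    Shift-t = record
      { F-cong     = *ₗ-congˡ
      ; surjective = λ y → t-inv y , t-t-inv y
      ; forward    = Fil-t
      ; backward   = λ {k} h → Fil-subst (i-j+j≡i k r) (Fil-t-cancel h)
      }

    Shift-t⁻¹ : Shift r t-inv
    Shift-t⁻¹ = record
      { F-cong     = λ {x} {y} x≈y → t-inj (≈ᴹ-trans (t-t-inv x) (≈ᴹ-trans x≈y (≈ᴹ-sym (t-t-inv y))))
      ; surjective = λ y → t *ₗ y , t-inj (t-t-inv (t *ₗ y))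
      ; forward    = λ {k} {x} h → Fil-t-cancel (Fil-resp (≈ᴹ-sym (t-t-inv x)) h)
      ; backward   = λ {k} {x} h → Fil-subst (i+j-j≡i k r) (Fil-resp (t-t-inv x) (Fil-t h))
      }

    Shift-t^ : ∀ u → Shift (ℤ.- (u ℤ.* r)) (t^ K f c₀≉0 M M≅ u)
    Shift-t^ (+ zero)     = Shift-subst (lemma r) Shift-id
      where
      lemma : ∀ r → + 0 ≡ ℤ.- (+ 0 ℤ.* r)
      lemma = solve-∀
    Shift-t^ (+ suc i)    = Shift-subst (lemma (+ i) r) (Shift-∘ Shift-t (Shift-t^ (+ i)))
      where
      lemma : ∀ i r → ℤ.- (i ℤ.* r) ℤ.+ ℤ.- r ≡ ℤ.- ((+ 1 ℤ.+ i) ℤ.* r)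
      lemma = solve-∀
    Shift-t^ -[1+ zero ]  = Shift-subst (lemma r) Shift-t⁻¹
      where
      lemma : ∀ r → r ≡ ℤ.- (-[1+ 0 ] ℤ.* r)
      lemma = solve-∀
    Shift-t^ -[1+ suc i ] = Shift-subst (lemma -[1+ i ] r) (Shift-∘ Shift-t⁻¹ (Shift-t^ -[1+ i ]))
      where
      lemma : ∀ i r → ℤ.- (i ℤ.* r) ℤ.+ r ≡ ℤ.- ((-[1+ 0 ] ℤ.+ i) ℤ.* r)
      lemma = solve-∀

    Shift-σ^t^ : ∀ k u → Shift (+ d ℤ.* k ℤ.- u ℤ.* r) (σ^t^ K f c₀≉0 M M≅ σ-unif k u)
    Shift-σ^t^ k u = Shift-subst (ℤ.+-comm (ℤ.- (u ℤ.* r)) (+ d ℤ.* k))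
      (Shift-∘ (Shift-const (v-uniformizer^ σ-unif k)) (Shift-t^ u))

    -- Surjectivity gives a preimage of each point of `Fil k`, and `backward` keeps it in `Fil k`.
    Shift-0-image : ∀ {F k} → Shift (+ 0) F → image M F (Fil k) ≐ Fil k
    Shift-0-image {F} {k} S =
        (λ { (x , x∈ , y≈Fx) → Fil-subst (ℤ.+-identityʳ k)
               (Fil-resp (≈ᴹ-sym y≈Fx) (forward S x∈)) })
      , (λ {y} y∈ → let x , Fx≈y = surjective S y in
           x , backward S (Fil-subst (sym (ℤ.+-identityʳ k)) (Fil-resp (≈ᴹ-sym Fx≈y) y∈))
             , ≈ᴹ-sym Fx≈y)

    t⁻¹-Fil-⊆ : ∀ {k} → + 0 ℤ.≤ r → image M (t^ K f c₀≉0 M M≅ -[1+ 0 ]) (Fil k) ⊆ Fil k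
    t⁻¹-Fil-⊆ {k} 0≤r (x , x∈ , y≈t⁻¹x) = Fil-resp (≈ᴹ-sym y≈t⁻¹x)
      (Fil-weaken (subst (ℤ._≤ k ℤ.+ r) (ℤ.+-identityʳ k) (ℤ.+-monoʳ-≤ k 0≤r))
        (forward Shift-t⁻¹ x∈))

    -- The lattice `Fil 0` and its basis

    V : LeftModule ring m ℓm
    V = restrict M

    open Lattices K V

    -- Unlike in `t^`, the recursion moves t onto the vector first, in step with `tabulate-*ₗ`,
    -- where peeling off a coefficient replaces x by t x.
    t-power : ℕ → Carrierᴹ → Carrierᴹ
    t-power zero    x = x
    t-power (suc i) x = t-power i (t *ₗ x)

    Fil-t-power : ∀ i {k x} → Fil k x → Fil (k ℤ.- + i ℤ.* r) (t-power i x)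
    Fil-t-power zero    {k} h = Fil-subst (lemma k r) h
      where
      lemma : ∀ k r → k ≡ k ℤ.- + 0 ℤ.* r
      lemma = solve-∀
    Fil-t-power (suc i) {k} h = Fil-subst (lemma k (+ i) r) (Fil-t-power i (Fil-t h))
      where
      lemma : ∀ k i r → (k ℤ.- r) ℤ.- i ℤ.* r ≡ k ℤ.- (+ 1 ℤ.+ i) ℤ.* r
      lemma = solve-∀

    tabulate-*ₗ : ∀ {N} (a : Fin N → Carrier) x →
      tabulate a *ₗ x ≈ᴹ linearCombination a (λ i → t-power (toℕ i) x)
    tabulate-*ₗ {zero}  a x = *ₗ-zeroˡ x
    tabulate-*ₗ {suc N} a x = begin
      (a₀ ∷ p) *ₗ x                          ≈⟨ *ₗ-cong (∷-cong (≈-sym (+-identityʳ a₀)) ≋-refl) ≈ᴹ-refl ⟩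
      (const a₀ ⊕ (0# ∷ p)) *ₗ x             ≈⟨ *ₗ-distribʳ x (const a₀) (0# ∷ p) ⟩
      const a₀ *ₗ x +ᴹ (0# ∷ p) *ₗ x         ≈⟨ +ᴹ-congˡ (*ₗ-cong (≋-sym (⊗-t p)) ≈ᴹ-refl) ⟩
      const a₀ *ₗ x +ᴹ (p ⊗ t) *ₗ x          ≈⟨ +ᴹ-congˡ (*ₗ-assoc p t x) ⟩
      const a₀ *ₗ x +ᴹ p *ₗ (t *ₗ x)         ≈⟨ +ᴹ-congˡ (tabulate-*ₗ (a ∘ Fin.suc) (t *ₗ x)) ⟩
      linearCombination a (λ i → t-power (toℕ i) x) ∎
      where
      a₀ = a Fin.zero
      p  = tabulate (a ∘ Fin.suc)

    private
      exponent : ℕ → ℤ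
      exponent i = proj₁ (ceiling d (+ i ℤ.* r))

      scale : ℕ → Carrier
      scale i = uniformizer^ σ-unif (exponent i)

      v-scale : ∀ i → v (scale i) ≡ [ exponent i ]
      v-scale i = v-uniformizer^ σ-unif (exponent i)

      scale≉0 : ∀ i → ¬ scale i ≈ 0#
      scale≉0 i s≈0 with () ← trans (sym (v-scale i)) (≈0⇒v≡∞ s≈0)

      scale⁻¹ : ℕ → Carrier
      scale⁻¹ i = proj₁ (invertible (scale≉0 i))

      scale⁻¹-scale : ∀ i → scale⁻¹ i * scale i ≈ 1#
      scale⁻¹-scale i = proj₁ (proj₂ (invertible (scale≉0 i)))

      scale-scale⁻¹ : ∀ i → scale i * scale⁻¹ i ≈ 1#
      scale-scale⁻¹ i = proj₂ (proj₂ (invertible (scale≉0 i)))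

    -- σ^⌈ir/d⌉ tⁱ e, where ⌈ir/d⌉ is the least valuation of a coefficient of tⁱ
    -- allowed in Fil 0.
    basis : Fin d → Carrierᴹ
    basis i = const (scale (toℕ i)) *ₗ t-power (toℕ i) e

    basis-Fil : ∀ i → Fil (+ 0) (basis i)
    basis-Fil i = Fil-weaken (subst (+ 0 ℤ.≤_) (lemma (+ d ℤ.* exponent j) (+ j ℤ.* r))
        (ℤ.i≤j⇒0≤j-i (proj₁ (proj₂ (ceiling d (+ j ℤ.* r))))))
      (Fil-*ₗ (v≡⇒≼ (v-scale j)) (Fil-t-power j e-Fil))
      where
      j = toℕ i
      lemma : ∀ x y → x ℤ.- y ≡ x ℤ.+ (+ 0 ℤ.- y)
      lemma = solve-∀
      e-Fil : Fil (+ 0) e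
      e-Fil = fil (const 1#) (≼ᴾ-∷ (𝒪⇒0≼ (subst ([ + 0 ] ≤⁺_) (sym v-1) [ ℤ.≤-refl ])) ≼ᴾ-[])
        (≈ᴹ-sym (*ₗ-identityˡ e))

    basis-combination : ∀ a →
      linearCombination a basis ≈ᴹ tabulate (λ i → a i * scale (toℕ i)) *ₗ e
    basis-combination a = ≈ᴹ-trans
      (sum-cong-≋ λ i → ≈ᴹ-trans
        (≈ᴹ-sym (*ₗ-assoc (const (a i)) (const (scale (toℕ i))) (t-power (toℕ i) e)))
        (*ₗ-cong (≋-sym (const-*-homo (a i) (scale (toℕ i)))) ≈ᴹ-refl))
      (≈ᴹ-sym (tabulate-*ₗ (λ i → a i * scale (toℕ i)) e))

    -- The scale is divided out on the right, because coordinates multiply basis vectors, hence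
    -- scales, from the left.
    coordinates : Poly → Fin d → Carrier
    coordinates q i = coeff q (toℕ i) * scale⁻¹ (toℕ i)

    coordinates-combination : ∀ {q} → DegreeBelow d q →
      q *ₗ e ≈ᴹ linearCombination (coordinates q) basis
    coordinates-combination {q} below = ≈ᴹ-sym (≈ᴹ-trans (basis-combination (coordinates q))
      (*ₗ-cong (mk (coeff-tabulate _ (coeff q)
        (λ i → inverse-cancel (scale⁻¹-scale (toℕ i)) (coeff q (toℕ i))) below)) ≈ᴹ-refl))

    -- Existence and uniqueness of representatives of degree below d; the scales are invertible.
    basis-isBasis : IsBasis basis
    basis-isBasis = record { independent = independent ; spanning = spanning }
      where
      independent : ∀ a → linearCombination a basis ≈ᴹ 0ᴹ → ∀ i → a i ≈ 0#
      independent a a·b≈0 i = ≈-trans (≈-sym (inverse-cancel (scale-scale⁻¹ (toℕ i)) (a i)))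
        (≈-trans (*-congʳ aᵢs≈0) (zeroˡ _))
        where
        a′ : Fin d → Carrier
        a′ i = a i * scale (toℕ i)
        aᵢs≈0 : a i * scale (toℕ i) ≈ 0#
        aᵢs≈0 = subst (_≈ 0#) (coeff-tabulate-toℕ a′ i)
          (reduced-zero (tabulate-DegreeBelow a′)
            (≈ᴹ-trans (≈ᴹ-sym (basis-combination a)) a·b≈0) .at (toℕ i))

      spanning : ∀ x → ∃[ a ] x ≈ᴹ linearCombination a basis
      spanning x with p , x≈pe ← generates x with q , below , qe≈pe , _ ← reduce p =
        coordinates q , ≈ᴹ-trans x≈pe (≈ᴹ-trans (≈ᴹ-sym qe≈pe) (coordinates-combination below))

    -- From i r ≤ d v(qᵢ) the minimality of the ceiling gives ⌈ir/d⌉ ≤ v(qᵢ), so dividing by the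
    -- scale leaves a nonnegative value.
    coordinates-𝒪 : ∀ {q} → + 0 ≼ᴾ q → ∀ i → 𝒪 (coordinates q i)
    coordinates-𝒪 {q} h i with v (coeff q (toℕ i)) in e | v-* (coeff q (toℕ i)) (scale⁻¹ (toℕ i))
    ... | ⊤⁺    | eq = subst ([ + 0 ] ≤⁺_) (sym eq) ([ + 0 ] ≤⊤⁺)
    ... | [ k ] | eq = subst ([ + 0 ] ≤⁺_)
      (sym (trans eq (cong ([ k ] +∞_) (v-inverse (scale-scale⁻¹ (toℕ i)) (v-scale (toℕ i))))))
      [ ℤ.i≤j⇒0≤j-i (proj₂ (proj₂ (ceiling d (+ toℕ i ℤ.* r))) k
        (subst (ℤ._≤ + d ℤ.* k) (ℤ.+-identityˡ _) (_≼_.at (h .at (toℕ i)) k e))) ]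

    Fil-isLattice : IsLattice (Fil (+ 0))
    Fil-isLattice = record
      { is𝒪Submodule = record
        { resp      = Fil-resp
        ; 0-closed  = Fil-0
        ; +-closed  = Fil-+
        ; *ₗ-closed = Fil-𝒪-*ₗ
        }
      ; isFinitelyGenerated = d , basis , basis-Fil , generated
      ; containsBasis = d , basis , basis-isBasis , basis-Fil
      }
      where
      generated : ∀ {x} → Fil (+ 0) x →
        ∃[ a ] (∀ i → 𝒪 (a i)) × x ≈ᴹ linearCombination a basis
      -- The representative p can have degree d or more; its reduction still has weight 0 and
      -- supplies the coordinates.
      generated (fil p h x≈pe) with q , below , qe≈pe , weight ← reduce p =
        coordinates q , coordinates-𝒪 (weight (+ 0) h) ,
        ≈ᴹ-trans x≈pe (≈ᴹ-trans (≈ᴹ-sym qe≈pe) (coordinates-combination below))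

    -- The position of an arbitrary lattice in the filtration

    lattice-bounded : ∀ {Λ : Pred Carrierᴹ ℓₚ} → IsLattice Λ → ∃[ k ] Λ ⊆ Fil k
    lattice-bounded L with _ , g , _ , generated ← IsLattice.isFinitelyGenerated L
                      with k , g∈ ← Fil-exists-family g =
      -- Finitely many generators share a level k, and coefficients in 𝒪 do not lower it.
      k , λ x∈Λ → let a , a∈𝒪 , x≈ = generated x∈Λ in
        Fil-resp (≈ᴹ-sym x≈) (Fil-sum λ i → Fil-𝒪-*ₗ (a∈𝒪 i) (g∈ i))

    -- Otherwise the basis in Λ would vanish by separatedness, and with it the generator e, which it
    -- spans.
    lattice-unbounded : ∀ {Λ : Pred Carrierᴹ ℓₚ} → IsLattice Λ → ¬ (∀ k → Λ ⊆ Fil k)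
    lattice-unbounded L Λ⊆ with N , b , isBasis , b∈Λ ← IsLattice.containsBasis L
      with a , e≈ ← IsBasis.spanning isBasis e = generator≉0 (≈ᴹ-trans e≈ (≈ᴹ-trans
        (sum-cong-≋ λ i → ≈ᴹ-trans (*ₗ-congˡ (Fil-separated λ k → Λ⊆ k (b∈Λ i))) (*ₗ-zeroʳ _))
        (sum-replicate-zero N)))

    -- Each step gains δ ≥ 1, so from the initial level k₀ any k is reached in |k - k₀| steps; the
    -- absolute value also covers k below k₀.
    lattice-not-improvable : ∀ {Λ : Pred Carrierᴹ ℓₚ} → IsLattice Λ → ∀ {δ} → + 0 ℤ.< δ →
      ¬ (∀ k → Λ ⊆ Fil k → Λ ⊆ Fil (k ℤ.+ δ))
    lattice-not-improvable {Λ = Λ} L {δ} 0<δ step with k₀ , Λ⊆ ← lattice-bounded L =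
      lattice-unbounded L λ k → λ x∈Λ →
        Fil-weaken (ℤ.≤-trans (ℤ.≤-reflexive (lemma k k₀)) (ℤ.+-monoʳ-≤ k₀ (i≤∣i∣ (k ℤ.- k₀))))
          (climb ℤ.∣ k ℤ.- k₀ ∣ x∈Λ)
      where
      lemma : ∀ k k₀ → k ≡ k₀ ℤ.+ (k ℤ.- k₀)
      lemma = solve-∀
      i≤∣i∣ : ∀ i → i ℤ.≤ + ℤ.∣ i ∣
      i≤∣i∣ (+ i)    = ℤ.≤-refl
      i≤∣i∣ -[1+ i ] = ℤ.-≤+
      climb : ∀ i → Λ ⊆ Fil (k₀ ℤ.+ + i)
      climb zero    x∈Λ = Fil-subst (sym (ℤ.+-identityʳ k₀)) (Λ⊆ x∈Λ)
      climb (suc i) x∈Λ = Fil-weaken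
        (ℤ.≤-trans (ℤ.≤-reflexive (next k₀ (+ i))) (ℤ.+-monoʳ-≤ (k₀ ℤ.+ + i) (ℤ.i<j⇒suc[i]≤j 0<δ)))
        (step (k₀ ℤ.+ + i) (climb i) x∈Λ)
        where
        next : ∀ k i → k ℤ.+ (+ 1 ℤ.+ i) ≡ (k ℤ.+ i) ℤ.+ + 1
        next = solve-∀

    -- For δ > 0 every point of Λ is some F x and lies δ higher than x. For δ < 0 the roles are
    -- exchanged: F x lies in Λ, and `backward` places x itself - δ higher.
    stable-lattice-shift : ∀ {Λ : Pred Carrierᴹ ℓₚ} → IsLattice Λ → ∀ {δ F} → Shift δ F →
      image M F Λ ≐ Λ → δ ≡ + 0
    stable-lattice-shift L {δ} {F} S (FΛ⊆Λ , Λ⊆FΛ) with ℤ.<-cmp δ (+ 0)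
    ... | tri≈ _ δ≡0 _ = δ≡0
    ... | tri> _ _ 0<δ = ⊥-elim (lattice-not-improvable L 0<δ λ k Λ⊆ y∈Λ →
      let x , x∈Λ , y≈Fx = Λ⊆FΛ y∈Λ in Fil-resp (≈ᴹ-sym y≈Fx) (forward S (Λ⊆ x∈Λ)))
    ... | tri< δ<0 _ _ = ⊥-elim (lattice-not-improvable L (ℤ.neg-mono-< δ<0) λ k Λ⊆ {x} x∈Λ →
      backward S (Fil-subst (sym (i-j+j≡i k δ)) (Λ⊆ (FΛ⊆Λ (x , x∈Λ , ≈ᴹ-refl)))))

open CompleteDVSkewField using (Carrier; _≈_; 0#; ring; IsUniformizer)
open Polynomial using (Poly; coeff; IsMonicOfDegree; polynomialRing; restrict)
open LeftModule using (Carrierᴹ)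
open Lattices using (IsLattice)

theorem3p7 : ∀ {c ℓ m ℓm p : Level}
    (ℒ : CompleteDVSkewField c ℓ) {σ : Carrier ℒ} (σ-unif : IsUniformizer ℒ σ)
    (d : ℕ) → 1 ℕ.≤ d →
    (f : Poly (ring ℒ)) → IsMonicOfDegree (ring ℒ) d f →
    (c₀≉0 : ¬ (_≈_ ℒ (coeff (ring ℒ) f 0) (0# ℒ))) →
    (s : ℚ) → IsSingleEdge (NewtonPolygon ℒ f) s →
    (M : LeftModule (polynomialRing (ring ℒ)) m ℓm) →
    (M≅ : M ≅ cyclicModule (polynomialRing (ring ℒ)) f) →
    ∃[ r ] (fromℤ r ≡ fromℤ (+ d) ℚ.* s)
    × (∃ λ (Λ : Pred (Carrierᴹ M) (c ⊔ ℓm)) →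
    IsLattice ℒ (restrict (ring ℒ) M) Λ
    × (image M (σ^t^ ℒ f c₀≉0 M M≅ σ-unif r (+ d)) Λ ≐ Λ))
    × (0ℚ ℚ.< s →
    ∃ λ (Λ : Pred (Carrierᴹ M) (c ⊔ ℓm)) →
    IsLattice ℒ (restrict (ring ℒ) M) Λ
    × (image M (σ^t^ ℒ f c₀≉0 M M≅ σ-unif r (+ d)) Λ ≐ Λ)
    × (image M (t^ ℒ f c₀≉0 M M≅ (-[1+ 0 ])) Λ ⊆ Λ))
    × ((v u : ℤ) (u≢0 : u ≢ + 0) (Λ′ : Pred (Carrierᴹ M) p) →
    IsLattice ℒ (restrict (ring ℒ) M) Λ′ →
    image M (σ^t^ ℒ f c₀≉0 M M≅ σ-unif v u) Λ′ ≐ Λ′ →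
    quotient v u u≢0 ≡ s)
-- The empty list is the zero polynomial, whose constant coefficient is 0.
theorem3p7 ℒ σ-unif (suc n) 1≤d [] monic c₀≉0 = contradiction (CompleteDVSkewField.refl ℒ) c₀≉0
theorem3p7 ℒ σ-unif (suc n) 1≤d (c₀ ∷ f′) monic c₀≉0 s edge M M≅ =
  r , r≡ds
  , (Fil (+ 0) , Fil-isLattice , stable)
  , (λ 0<s → Fil (+ 0) , Fil-isLattice , stable , t⁻¹-Fil-⊆ (0≤r 0<s))
  , λ v u u≢0 Λ′ L σᵛtᵘΛ′≐Λ′ → quotient-slope d u≢0 r≡ds
      -- The map displaces by d v - u r, which stability forces to be 0.
      (ℤ.i-j≡0⇒i≡j (+ d ℤ.* v) (u ℤ.* r)
        (stable-lattice-shift L (Shift-σ^t^ v u) σᵛtᵘΛ′≐Λ′))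
  where
  c₀-finite = Valuation.≉0⇒v-finite ℒ c₀≉0
  vc₀ = proj₂ c₀-finite

  r≡ds = Newton.newton-slope ℒ {f = c₀ ∷ f′} 1≤d monic vc₀ edge

  open Filtration.OfModule ℒ σ-unif c₀ f′ monic c₀≉0 vc₀
    (Newton.newton-≥ ℒ {f = c₀ ∷ f′} 1≤d monic vc₀ {s} edge) M M≅

  stable = Shift-0-image (Shift-subst (ℤ.+-inverseʳ (+ d ℤ.* r)) (Shift-σ^t^ r (+ d)))

  0≤r : 0ℚ ℚ.< s → + 0 ℤ.≤ r
  0≤r 0<s = fromℤ-cancel-≤ {+ 0} {r} (subst₂ ℚ._≤_ (ℚ.*-zeroʳ (fromℤ (+ d))) (sym r≡ds)
    (ℚ.*-monoˡ-≤-nonNeg (fromℤ (+ d)) {{ℚ.normalize-nonNeg d 1}} (ℚ.<⇒≤ 0<s)))
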